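{- Let $\vec S$ be a submodular separation system without degenerate elements in a distributive universe $\vec U$ of separations, and let $Q\subseteq\vec U$ be down-closed. Then exactly one of the following assertions holds: (i) $S$ has an abstract tangle extending $Q$. (ii) There exists an $S$-tree over $\mathcal T^*\cup\mathcal F_Q$.
   Context: A separation system $(\vec S,\le,{}^*)$ is a partially ordered set with an order-reversing involution $^*:\vec S\to\vec S$. Its elements are called oriented separations. An (unoriented) separation is a set $s=\{\vec s,\vec s^{\,*}\}$; $S$ denotes the set of all these. $\vec s$ is degenerate if $\vec s=\vec s^{\,*}$. A universe of separations is a separation system $\vec U$ whose partial order is a lattice (join $\vee$, meet $\wedge$); it is distributive if this lattice is distributive. A separation system $\vec S$ in $\vec U$ is a subset of $\vec U$ closed under $^*$, with the induced order and involution. It is submodular if for all $\vec s,\vec t\in\vec S$ at least one of $\vec s\vee\vec t$, $\vec s\wedge\vec t$ (computed in $\vec U$) lies in $\vec S$. $\vec x\in\vec U$ is co-small if $\vec x^{\,*}\le\vec x$. $Q\subseteq\vec U$ is down-closed if $\vec r\le\vec s\in Q$ implies $\vec r\in Q$ for all $\vec r,\vec s\in\vec U$. An orientation of $S$ is a set $O\subseteq\vec S$ containing exactly one of $\vec s,\vec s^{\,*}$ for every $s\in S$. It is consistent if whenever $r,s\in S$ are distinct with orientations $\vec r\le\vec s\in O$, then $\vec r^{\,*}\notin O$. Let $\mathcal T$ be the set of all sets $\{\vec r,\vec s,\vec t\}\subseteq\vec U$ ($\vec r,\vec s,\vec t$ not necessarily distinct) such that $\vec r\vee\vec s\vee\vec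 t$ is co-small. An abstract tangle of $S$ is a consistent orientation $O$ of $S$ such that no subset of $O$ is an element of $\mathcal T$. It extends $Q$ if $Q\cap\vec S\subseteq O$. A star is a set $\sigma$ of non-degenerate oriented separations such that $\vec s\le\vec t^{\,*}$ for any two distinct $\vec s,\vec t\in\sigma$; $\mathcal T^*$ is the set of all elements of $\mathcal T$ that are stars. Further, $\mathcal F_Q:=\{\{\vec s^{\,*}\}:\vec s\in Q\text{ non-degenerate}\}$. An $S$-tree is a pair $(T,\alpha)$ of a tree $T$ and a map $\alpha$ from the set $\vec E(T)=\{(x,y): xy\in E(T)\}$ of orientations of edges of $T$ to $\vec S$ such that $\alpha(y,x)=\alpha(x,y)^*$ for all $xy\in E(T)$. For $\mathcal F\subseteq 2^{\vec U}$ it is an $S$-tree over $\mathcal F$ if $\alpha(F_t)\in\mathcal F$ for every node $t$ of $T$, where $F_t=\{(s,t): st\in E(T)\}$. -}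

module Defs where

open import Level using (Level; _⊔_) renaming (suc to lsuc)
open import Algebra.Core using (Op₁; Op₂)
open import Data.Bool.Base using (Bool; T)
open import Data.Fin.Base using (Fin; zero; suc; inject₁; fromℕ)
open import Data.Nat.Base using (ℕ; _+_; NonZero)
open import Data.Product.Base using (_×_; Σ-syntax; ∃-syntax)
open import Data.Sum.Base using (_⊎_)
open import Function.Definitions using (Injective)
open import Induction.WellFounded using (WellFounded)
open import Relation.Binary.Bundles using (Poset)
open import Relation.Binary.Construct.Closure.ReflexiveTransitive using (Star)
open import Relation.Binary.Core using (Rel)
open import Relation.Binary.Definitions using (_Respects_)
open import Relation.Binary.Lattice.Definitions using (Supremum; Infimum)
open import Relation.Binary.Lattice.Structures using (IsDistributiveLattice)
open import Relation.Binary.PropositionalEquality.Core using (_≡_)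
open import Relation.Binary.Structures using (IsStrictTotalOrder)
open import Relation.Nullary.Negation.Core using (¬_)
open import Relation.Unary using (Pred; _∈_; _∉_; _⊆_; _∩_; _≐_)

-- The axiom of choice, in Zermelo's form: every type has a well-ordering.

WellOrderingPrinciple : ∀ ℓ → Set (lsuc ℓ)
WellOrderingPrinciple ℓ =
  ∀ (A : Set ℓ) → Σ[ R ∈ Rel A ℓ ] (IsStrictTotalOrder _≡_ R × WellFounded R)

ExactlyOne : ∀ {a b} → Set a → Set b → Set (a ⊔ b)
ExactlyOne A B = (A ⊎ B) × ¬ (A × B)

-- Finite simple graphs.  Adjacency is Bool-valued so that an adjacent pair
-- of nodes carries exactly one proof of adjacency, hence is exactly one
-- oriented edge.

record Graph : Set where
  field
    order : ℕ
    adj   : Fin order → Fin order → Bool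

  Node : Set
  Node = Fin order

  Edge : Node → Node → Set
  Edge x y = T (adj x y)

  field
    Edge-sym    : ∀ {x y} → Edge x y → Edge y x
    Edge-irrefl : ∀ {x} → ¬ Edge x x

  Connected : Set
  Connected = ∀ x y → Star Edge x y

  -- A cycle of length k + 3: distinct nodes c 0, …, c (k + 2), each adjacent
  -- to the next and the last adjacent to the first.
  record Cycle (k : ℕ) : Set where
    field
      c           : Fin (3 + k) → Node
      c-injective : Injective _≡_ _≡_ c
      c-step      : ∀ (i : Fin (2 + k)) → Edge (c (inject₁ i)) (c (suc i))
      c-close     : Edge (c (fromℕ (2 + k))) (c zero)

  Acyclic : Set
  Acyclic = ∀ k → ¬ Cycle k

-- Trees are finite and have at least one node.  Finiteness matters: on a
-- two-way infinite path, sending all edges oriented forwards to one fixed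
-- separation s and all edges oriented backwards to its inverse would give
-- {s , s *} at every node, which lies in 𝓣* below whenever s is not
-- degenerate.

record Tree : Set where
  field
    graph : Graph
  open Graph graph public
  field
    nonEmpty  : NonZero order
    connected : Connected
    acyclic   : Acyclic

record SeparationSystem (ℓ : Level) : Set (lsuc ℓ) where
  infixl 8 _*
  field
    poset : Poset ℓ ℓ ℓ
  open Poset poset public
  field
    _*           : Op₁ Carrier
    *-involutive : ∀ x → x * * ≈ x
    *-antitone   : ∀ {x y} → x ≤ y → y * ≤ x *

record Universe (ℓ : Level) : Set (lsuc ℓ) where
  infixr 6 _∨_
  infixr 7 _∧_
  field
    separationSystem : SeparationSystem ℓ
  open SeparationSystem separationSystem public
  field
    _∨_      : Op₂ Carrier
    _∧_      : Op₂ Carrier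
    supremum : Supremum _≤_ _∨_
    infimum  : Infimum _≤_ _∧_

  Distributive : Set ℓ
  Distributive = IsDistributiveLattice _≈_ _≤_ _∨_ _∧_

-- Sets of oriented separations are predicates on Carrier that respect _≈_;
-- families of such sets are predicates on predicates, closed under _≐_.

module Separations {ℓ : Level} (U : Universe ℓ) where
  open Universe U

  Subset : Set (lsuc ℓ)
  Subset = Pred Carrier ℓ

  Family : Set (lsuc ℓ)
  Family = Pred Subset ℓ

  ｛_｝ : Carrier → Subset
  ｛ r ｝ x = x ≈ r

  ｛_,_,_｝ : Carrier → Carrier → Carrier → Subset
  ｛ r , s , t ｝ x = x ≈ r ⊎ x ≈ s ⊎ x ≈ t

  Degenerate : Pred Carrier ℓ
  Degenerate s = s ≈ s *

  CoSmall : Pred Carrier ℓ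
  CoSmall s = s * ≤ s

  -- {r , r *} = {s , s *}
  SameSeparation : Rel Carrier ℓ
  SameSeparation r s = r ≈ s ⊎ r ≈ s *

  record IsSystem (S : Subset) : Set ℓ where
    field
      respects : S Respects _≈_
      *-closed : ∀ {s} → s ∈ S → s * ∈ S

  Submodular : Subset → Set ℓ
  Submodular S = ∀ {s t} → s ∈ S → t ∈ S → (s ∨ t) ∈ S ⊎ (s ∧ t) ∈ S

  NoDegenerate : Subset → Set ℓ
  NoDegenerate S = ∀ {s} → s ∈ S → ¬ Degenerate s

  DownClosed : Subset → Set ℓ
  DownClosed Q = ∀ {r s} → r ≤ s → s ∈ Q → r ∈ Q

  record IsOrientation (S O : Subset) : Set ℓ where
    field
      respects : O Respects _≈_
      subset   : O ⊆ S
      -- O contains exactly one element of the set {s , s *}, which is a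
      -- singleton if s is degenerate.
      atLeast  : ∀ {s} → s ∈ S → s ∈ O ⊎ s * ∈ O
      atMost   : ∀ {s} → s ∈ O → s * ∈ O → Degenerate s

  Consistent : (S O : Subset) → Set ℓ
  Consistent S O = ∀ {r s} → r ∈ S → s ∈ S → ¬ SameSeparation r s →
                   r ≤ s → s ∈ O → r * ∉ O

  𝓣 : Family
  𝓣 X = ∃[ r ] ∃[ s ] ∃[ t ] (X ≐ ｛ r , s , t ｝ × CoSmall (r ∨ s ∨ t))

  IsStar : Family
  IsStar σ = (∀ {s} → s ∈ σ → ¬ Degenerate s)
           × (∀ {s t} → s ∈ σ → t ∈ σ → ¬ s ≈ t → s ≤ t *)

  𝓣* : Family
  𝓣* = 𝓣 ∩ IsStar

  𝓕 : Subset → Family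
  𝓕 Q X = ∃[ s ] (s ∈ Q × ¬ Degenerate s × X ≐ ｛ s * ｝)

  record IsAbstractTangle (S O : Subset) : Set (lsuc ℓ) where
    field
      isOrientation : IsOrientation S O
      consistent    : Consistent S O
      avoids        : ∀ (X : Subset) → X ∈ 𝓣 → ¬ X ⊆ O

  HasTangleExtending : (S Q : Subset) → Set (lsuc ℓ)
  HasTangleExtending S Q = ∃[ O ] (IsAbstractTangle S O × Q ∩ S ⊆ O)

  record STree (S : Subset) : Set ℓ where
    field
      tree : Tree
    open Tree tree public
    field
      α     : ∀ {x y} → Edge x y → Carrier
      α-∈   : ∀ {x y} (e : Edge x y) → α e ∈ S
      α-sym : ∀ {x y} (e : Edge x y) → α (Edge-sym e) ≈ α e *

    -- The image α(F_t), where F_t consists of the edges oriented towards t.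
    αF : Node → Subset
    αF t x = ∃[ s ] Σ[ e ∈ Edge s t ] x ≈ α e

  HasSTreeOver : Subset → Family → Set ℓ
  HasSTreeOver S F = Σ[ τ ∈ STree S ] (∀ t → STree.αF τ t ∈ F)

{-# OPTIONS --safe #-}
module Submission where

-- An orientation of a finite tree has a sink, so a tangle and an S-tree exclude
-- each other.  Conversely, let Q contain the small separations, suppose that there
-- is no S-tree over 𝓣* ∪ 𝓕 Q, and enlarge Q to a down-closed set maximal with this
-- property (trees are finite, so unions of chains are harmless).  Then S ∩ Q is a
-- tangle: a triple in 𝓣 uncrosses to a star in 𝓣* of smaller separations, which is
-- the centre of an S-tree with three leaves in Q; and if neither s nor s * were in
-- Q, there would be S-trees over 𝓣* ∪ 𝓕 (Q ∪ ↓s) and 𝓣* ∪ 𝓕 (Q ∪ ↓s *), which can be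
-- combined.  More generally this is done for ↓a and ↓b with a ≤ b *, by induction on
-- a and b inside a finite sublattice.  One may assume that everything below a or b
-- is in Q.  Then each tree has just one leaf outside Q, labelled a or b, and
-- submodularity yields some x between a and b * such that the two trees can be
-- shifted to have the labels x and x * at these leaves, where they fit together.

open import Defs
open import Axiom.ExcludedMiddle using (ExcludedMiddle)
open import Data.Bool.Base using (Bool; false; T)
open import Data.Bool.Properties using (T-irrelevant)
open import Data.Empty using (⊥; ⊥-elim)
open import Data.Fin.Base using (Fin; zero; suc; toℕ; inject₁; fromℕ)
import Data.Fin.Induction as FinInduction
open import Data.Fin.Properties
  using (_≟_; suc-injective; toℕ-inject₁; toℕ-fromℕ; toℕ-injective; toℕ<n; pigeonhole)
open import Data.Fin.Relation.Unary.Top as Top using (‵fromℕ; ‵inject₁)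
open import Data.List.Base using (List; []; _∷_; _++_; lookup; map; cartesianProductWith)
import Data.List.Membership.Setoid as Membership
import Data.List.Membership.Setoid.Properties as MembershipProperties
open import Data.List.Relation.Unary.All as All using (All; []; _∷_)
open import Data.List.Relation.Unary.All.Properties using (++⁺; ++⁻ˡ; ++⁻ʳ; map⁻)
open import Data.List.Relation.Unary.Any using (here; there)
open import Data.List.Relation.Unary.Any.Properties using (lookup-index)
open import Data.Nat.Base using (ℕ; zero; suc; _+_; _∸_; _<_; NonZero)
open import Data.Nat.Induction using (<-rec)
open import Data.Nat.Properties
  using ( +-suc; +-identityʳ; +-assoc; m+[n∸m]≡n; m<n⇒0<n∸m; m∸n≤m; m≢1+n+m
        ; <⇒≤; ≤-<-trans; <-cmp; n<1+n)
open import Data.Product.Base using (_×_; _,_; proj₁; proj₂; ∃-syntax; Σ-syntax)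
open import Data.Sum.Base using (_⊎_; inj₁; inj₂; [_,_]′) renaming (map₁ to ⊎-map₁)
open import Function.Base using (_∘_; id; _on_)
open import Function.Definitions using (Injective)
open import Induction.WellFounded using (WellFounded; Acc; acc)
open import Level using () renaming (suc to lsuc)
open import Relation.Binary.Construct.Closure.ReflexiveTransitive as Star
  using (Star; ε; _◅_; _◅◅_)
import Relation.Binary.Construct.On as On
open import Relation.Binary.Core using (Rel)
open import Relation.Binary.Definitions using (_Respects_; tri<; tri≈; tri>)
open import Relation.Binary.Lattice.Bundles using (DistributiveLattice)
import Relation.Binary.Lattice.Properties.DistributiveLattice as DistributiveLatticeProperties
import Relation.Binary.Lattice.Properties.JoinSemilattice as JoinProperties
import Relation.Binary.Lattice.Properties.MeetSemilattice as MeetProperties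
import Relation.Binary.Properties.Poset as PosetProperties
open import Relation.Binary.PropositionalEquality as ≡ using (_≡_; _≢_)
open import Relation.Binary.Structures using (IsStrictTotalOrder)
open import Relation.Nullary using (¬_; yes; no)
open import Relation.Nullary.Decidable using (decidable-stable; ⌊_⌋; toWitness; fromWitness)
open import Relation.Unary using (_∈_; _∉_; _⊆_; _∪_; _∩_; _≐_)
open import Relation.Unary.Properties using (≐-sym; ≐-trans)

-- Walks in acyclic graphs.

module _ (G : Graph) where
  open Graph G

  -- By pigeonhole the walk returns to a node. Strong induction on the return time `d` excludes
  -- this: `d = 1` is a loop, `d = 2` is a turn, and for `d = k + 3` the closed walk is a cycle, its
  -- nodes being distinct because shorter returns are already excluded.
  acyclic⇒walk-backtracks : Acyclic → (w : ℕ → Node) →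
    (∀ n → Edge (w n) (w (suc n))) → (∀ n → w n ≢ w (suc (suc n))) → ⊥
  acyclic⇒walk-backtracks acyclic w step forward
    with i , j , i<j , eq ← pigeonhole (n<1+n order) (λ k → w (toℕ k)) =
    noReturn (toℕ j ∸ toℕ i) (m<n⇒0<n∸m i<j) (toℕ i)
      (≡.trans eq (≡.cong w (≡.sym (m+[n∸m]≡n (<⇒≤ i<j)))))
    where
    NoReturn : ℕ → Set
    NoReturn d = 0 < d → ∀ i → w i ≢ w (i + d)

    close : ∀ d → (∀ {e} → e < d → NoReturn e) → NoReturn d
    close 1 _ _ i eq rewrite +-suc i 0 | +-identityʳ i =
      Edge-irrefl (≡.subst (Edge (w i)) (≡.sym eq) (step i))
    close 2 _ _ i eq rewrite +-suc i 1 | +-suc i 0 | +-identityʳ i = forward i eq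
    close (suc (suc (suc k))) rec _ i eq = acyclic k record
      { c           = c
      ; c-injective = c-injective
      ; c-step      = λ j → ≡.subst₂ Edge
          (≡.cong (λ m → w (i + m)) (≡.sym (toℕ-inject₁ j)))
          (≡.cong w (≡.sym (+-suc i (toℕ j))))
          (step (i + toℕ j))
      ; c-close     = ≡.subst₂ Edge
          (≡.cong (λ m → w (i + m)) (≡.sym (toℕ-fromℕ (2 + k))))
          (≡.trans (≡.cong w (≡.sym (+-suc i (2 + k))))
            (≡.trans (≡.sym eq) (≡.cong w (≡.sym (+-identityʳ i)))))
          (step (i + (2 + k)))
      }
      where
      c : Fin (3 + k) → Node
      c j = w (i + toℕ j)

      distinct : ∀ a b → b < 3 + k → a < b → w (i + a) ≢ w (i + b)
      distinct a b b<d a<b eq′ = rec (≤-<-trans (m∸n≤m b a) b<d) (m<n⇒0<n∸m a<b) (i + a)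
        (≡.trans eq′ (≡.cong w (≡.trans
          (≡.cong (i +_) (≡.sym (m+[n∸m]≡n (<⇒≤ a<b)))) (≡.sym (+-assoc i a (b ∸ a))))))

      c-injective : ∀ {a b} → c a ≡ c b → a ≡ b
      c-injective {a} {b} eq′ with <-cmp (toℕ a) (toℕ b)
      ... | tri< a<b _ _ = ⊥-elim (distinct _ _ (toℕ<n b) a<b eq′)
      ... | tri≈ _ a≡b _ = toℕ-injective a≡b
      ... | tri> _ _ b<a = ⊥-elim (distinct _ _ (toℕ<n a) b<a (≡.sym eq′))

    noReturn : ∀ d → NoReturn d
    noReturn = <-rec NoReturn close

-- Finite trees grown by attaching leaves.

-- A tree grown from a single node by attaching leaves; the newest node is zero.
data Parents : ℕ → Set where
  root : Parents 1
  grow : ∀ {n} → Parents n → Fin n → Parents (suc n)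

adjacent : ∀ {n} → Parents n → Fin n → Fin n → Bool
adjacent root       _       _       = false
adjacent (grow P p) zero    zero    = false
adjacent (grow P p) zero    (suc j) = ⌊ j ≟ p ⌋
adjacent (grow P p) (suc i) zero    = ⌊ i ≟ p ⌋
adjacent (grow P p) (suc i) (suc j) = adjacent P i j

adjacent-sym : ∀ {n} (P : Parents n) x y → T (adjacent P x y) → T (adjacent P y x)
adjacent-sym (grow P p) zero    (suc j) e = e
adjacent-sym (grow P p) (suc i) zero    e = e
adjacent-sym (grow P p) (suc i) (suc j) e = adjacent-sym P i j e

adjacent-irrefl : ∀ {n} (P : Parents n) x → ¬ T (adjacent P x x)
adjacent-irrefl (grow P p) (suc i) e = adjacent-irrefl P i e

graphOf : ∀ {n} → Parents n → Graph
graphOf {n} P = record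
  { order = n
  ; adj   = adjacent P
  ; Edge-sym    = λ {x} {y} → adjacent-sym P x y
  ; Edge-irrefl = λ {x} → adjacent-irrefl P x
  }

connectedOf : ∀ {n} (P : Parents n) → Graph.Connected (graphOf P)
connectedOf root zero zero = ε
connectedOf (grow P p) x y =
  toLeaf x ◅◅ Star.reverse (λ {x} {y} → adjacent-sym (grow P p) x y) (toLeaf y)
  where
  toLeaf : ∀ x → Star (Graph.Edge (graphOf (grow P p))) x zero
  toLeaf zero    = ε
  toLeaf (suc i) = Star.gmap suc id (connectedOf P i p) ◅◅ (fromWitness ≡.refl ◅ ε)

leaf-neighbour : ∀ {n} (P : Parents n) p x → T (adjacent (grow P p) zero x) → x ≡ suc p
leaf-neighbour P p (suc j) e = ≡.cong suc (toWitness e)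

-- The predecessor and the successor on a cycle are distinct neighbours, but the new leaf has only
-- its parent. Hence a cycle of the grown tree already lies in the smaller one.
leaf-off-cycle : ∀ {n} (P : Parents n) p {k} (C : Graph.Cycle (graphOf (grow P p)) k) →
  ∀ i → Graph.Cycle.c C i ≢ zero
leaf-off-cycle P p {k} C = two-neighbours
  where
  open Graph (graphOf (grow P p))
  open Cycle C

  unsym : ∀ i j → Edge (c i) (c j) → Edge (c j) (c i)
  unsym i j = adjacent-sym (grow P p) (c i) (c j)

  same : ∀ i j l → c i ≡ zero → Edge (c i) (c j) → Edge (c i) (c l) → j ≡ l
  same i j l ci≡0 e f rewrite ci≡0 =
    c-injective (≡.trans (leaf-neighbour P p (c j) e) (≡.sym (leaf-neighbour P p (c l) f)))

  two-neighbours : ∀ i → c i ≢ zero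
  two-neighbours zero c≡0
    with () ← same zero (suc zero) (fromℕ (2 + k)) c≡0
                (c-step zero) (unsym (fromℕ (2 + k)) zero c-close)
  two-neighbours (suc j) c≡0 with Top.view j
  -- At the last position the successor is `c zero`, along the closing edge; elsewhere the indices
  -- of the two neighbours differ by two.
  ... | ‵fromℕ
    with () ← same (fromℕ (2 + k)) (inject₁ j) zero c≡0
                (unsym (inject₁ j) (suc j) (c-step j)) c-close
  ... | ‵inject₁ j′ = m≢1+n+m (toℕ j′) (≡.trans
    (≡.sym (≡.trans (toℕ-inject₁ j) (toℕ-inject₁ j′)))
    (≡.cong toℕ (same (suc j) (inject₁ j) (suc (suc j′)) c≡0
      (unsym (inject₁ j) (suc j) (c-step j)) (c-step (suc j′)))))

acyclicOf : ∀ {n} (P : Parents n) → Graph.Acyclic (graphOf P)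
acyclicOf root k C = Graph.Cycle.c-step C zero
acyclicOf (grow P p) k C = acyclicOf P k record
  { c           = c′
  ; c-injective = λ {i} {j} eq → 
      c-injective (≡.trans (≡.sym (suc-c′ i)) (≡.trans (≡.cong suc eq) (suc-c′ j)))
  ; c-step      = λ i → lower (inject₁ i) (suc i) (c-step i)
  ; c-close     = lower (fromℕ (2 + k)) zero c-close
  }
  where
  open Graph (graphOf (grow P p)) using (Edge)
  open Graph.Cycle C

  lift-c : ∀ i → ∃[ j ] suc j ≡ c i
  lift-c i with c i | leaf-off-cycle P p C i
  ... | zero  | c≢0 = ⊥-elim (c≢0 ≡.refl)
  ... | suc j | _   = j , ≡.refl

  c′ = proj₁ ∘ lift-c
  suc-c′ = proj₂ ∘ lift-c

  lower : ∀ i j → Edge (c i) (c j) → T (adjacent P (c′ i) (c′ j))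
  lower i j = ≡.subst₂ Edge (≡.sym (suc-c′ i)) (≡.sym (suc-c′ j))

treeOf : ∀ {n} → Parents n → Tree
treeOf P = record
  { graph     = graphOf P
  ; nonEmpty  = nonEmpty P
  ; connected = connectedOf P
  ; acyclic   = acyclicOf P
  }
  where
  nonEmpty : ∀ {n} → Parents n → NonZero n
  nonEmpty root       = _
  nonEmpty (grow P p) = _

-- Minimal elements of well-founded relations.

minimal : ∀ {a} {A : Set a} {_⊏_ : Rel A a} → ExcludedMiddle a → {P : A → Set a} →
  ∀ {x} → Acc _⊏_ x → P x → ∃[ m ] (P m × (∀ {z} → P z → ¬ z ⊏ m))
minimal {_⊏_ = _⊏_} em {P} {x} (acc rs) Px with em {∃[ z ] (P z × (z ⊏ x))}
... | yes (z , Pz , z⊏x) = minimal em (rs z⊏x) Pz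
... | no none = x , Px , λ Pz z⊏x → none (_ , Pz , z⊏x)

-- Tangles exclude S-trees.

module _ {ℓ} (em : ExcludedMiddle ℓ) (U : Universe ℓ) where
  open Universe U
  open Separations U

  module _ {S O : Subset} (isO : IsOrientation S O) (τ : STree S) where
    open STree τ
    open IsOrientation isO

    HasOutEdge : Node → Set ℓ
    HasOutEdge t = ∃[ s ] Σ[ e ∈ Edge s t ] α e ∉ O

    -- An edge into `t` with label outside `O` is oriented away from `t` by `O`. If every node had
    -- one, following them would give an infinite walk. It never turns back, as `O` contains one of
    -- the two labels of each edge, which contradicts acyclicity.
    sink : ∃[ t ] (αF t ⊆ O)
    sink with em {∃[ t ] ¬ HasOutEdge t}
    ... | yes (t , noOut) = t , λ { (s , e , x≈αe) →
      respects (Eq.sym x≈αe) (decidable-stable em λ αe∉O → noOut (s , e , αe∉O)) }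
    ... | no noSink = ⊥-elim (acyclic⇒walk-backtracks graph acyclic walk
                        (λ n → Edge-sym (proj₁ (proj₂ (out (walk n)))))
                        (λ n → forward (walk n)))
      where
      out : ∀ t → HasOutEdge t
      out t = decidable-stable em λ noOut → noSink (t , noOut)

      next : Node → Node
      next t = proj₁ (out t)

      start : ∀ {n} → NonZero n → Fin n
      start {suc _} _ = zero

      walk : ℕ → Node
      walk zero    = start nonEmpty
      walk (suc n) = next (walk n)

      forward : ∀ t → ¬ t ≡ next (next t)
      forward t eq with out t
      ... | s , e , αe∉O with out s
      ... | t′ , e′ , αe′∉O with ≡.refl ← eq with atLeast (α-∈ e)
      ...   | inj₁ αe∈O = αe∉O αe∈O
      -- Adjacency has only one proof, so the edge `e′` taken back is `Edge-sym e`.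
      ...   | inj₂ αe*∈O = αe′∉O (≡.subst (λ f → α f ∈ O) (T-irrelevant (Edge-sym e) e′)
                                      (respects (Eq.sym (α-sym e)) αe*∈O))

  -- The star at a sink lies in the tangle. As a member of `𝓣` it is avoided; as the singleton of
  -- `s *` with `s ∈ Q` it clashes with `s`, which the tangle contains because it extends `Q`.
  tangle⇒¬tree : ∀ {S Q : Subset} → IsSystem S →
    HasTangleExtending S Q → ¬ HasSTreeOver S (𝓣* ∪ 𝓕 Q)
  tangle⇒¬tree isSystem (O , tangle , Q∩S⊆O) (τ , over)
    with sink (IsAbstractTangle.isOrientation tangle) τ
  ... | t , αF⊆O with over t
  ...   | inj₁ (αF∈𝓣 , _) = IsAbstractTangle.avoids tangle _ αF∈𝓣 αF⊆O
  ...   | inj₂ (s , s∈Q , s-nondeg , _ , s*⊆αF) = s-nondeg (atMost s∈O s*∈O)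
    where
    open IsOrientation (IsAbstractTangle.isOrientation tangle)
    s*∈O = αF⊆O (s*⊆αF Eq.refl)
    s∈S = IsSystem.respects isSystem (*-involutive s) (IsSystem.*-closed isSystem (subset s*∈O))
    s∈O = Q∩S⊆O (s∈Q , s∈S)

-- Involution and lattice operations in a distributive universe.

module TangleTreeDuality
  {ℓ} (em : ExcludedMiddle ℓ) (U : Universe ℓ) (distributive : Universe.Distributive U) where
  open Universe U
  open Separations U

  distributiveLattice : DistributiveLattice ℓ ℓ ℓ
  distributiveLattice = record { isDistributiveLattice = distributive }

  open DistributiveLattice distributiveLattice
    using ( x≤x∨y; y≤x∨y; ∨-least; x∧y≤x; x∧y≤y; ∧-greatest; ∧-distribˡ-∨
          ; joinSemilattice; meetSemilattice)
  open JoinProperties joinSemilattice using (∨-cong; ∨-monotonic; x≤y⇒x∨y≈y)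
  open MeetProperties meetSemilattice using (∧-cong; ∧-monotonic)
  open DistributiveLatticeProperties distributiveLattice using (∧-distribʳ-∨)

  *-cong : ∀ {x y} → x ≈ y → x * ≈ y *
  *-cong x≈y = antisym (*-antitone (reflexive (Eq.sym x≈y))) (*-antitone (reflexive x≈y))

  x≤x** : ∀ {x} → x ≤ x * *
  x≤x** = reflexive (Eq.sym (*-involutive _))

  x**≤x : ∀ {x} → x * * ≤ x
  x**≤x = reflexive (*-involutive _)

  ≤*-swap : ∀ {x y} → x ≤ y * → y ≤ x *
  ≤*-swap x≤y* = trans x≤x** (*-antitone x≤y*)

  *≤-swap : ∀ {x y} → x * ≤ y → y * ≤ x
  *≤-swap x*≤y = trans (*-antitone x*≤y) x**≤x

  *-cancel-≤ : ∀ {x y} → x * ≤ y * → y ≤ x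
  *-cancel-≤ x*≤y* = trans (≤*-swap x*≤y*) x**≤x

  deMorgan-∨ : ∀ {x y} → (x ∨ y) * ≈ x * ∧ y *
  deMorgan-∨ = antisym
    (∧-greatest (*-antitone (x≤x∨y _ _)) (*-antitone (y≤x∨y _ _)))
    (≤*-swap (∨-least (≤*-swap (x∧y≤x _ _)) (≤*-swap (x∧y≤y _ _))))

  deMorgan-∧ : ∀ {x y} → (x ∧ y) * ≈ x * ∨ y *
  deMorgan-∧ = antisym
    (*≤-swap (∧-greatest (*≤-swap (x≤x∨y _ _)) (*≤-swap (y≤x∨y _ _))))
    (∨-least (*-antitone (x∧y≤x _ _)) (*-antitone (x∧y≤y _ _)))

  [x∧y*]*≈y∨x* : ∀ {x y} → (x ∧ y *) * ≈ y ∨ x *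
  [x∧y*]*≈y∨x* = Eq.trans deMorgan-∧ (antisym
    (∨-least (y≤x∨y _ _) (trans x**≤x (x≤x∨y _ _)))
    (∨-least (trans x≤x** (y≤x∨y _ _)) (x≤x∨y _ _)))

  y≤x∨[y∨z] : ∀ {x y z} → y ≤ x ∨ y ∨ z
  y≤x∨[y∨z] = trans (x≤x∨y _ _) (y≤x∨y _ _)

  z≤x∨[y∨z] : ∀ {x y z} → z ≤ x ∨ y ∨ z
  z≤x∨[y∨z] = trans (y≤x∨y _ _) (y≤x∨y _ _)

  ∨-rotate : ∀ {x y z} → x ∨ y ∨ z ≤ y ∨ z ∨ x
  ∨-rotate = ∨-least z≤x∨[y∨z] (∨-monotonic refl (x≤x∨y _ _))

  Small : Subset
  Small s = s ≤ s *

  small-down : DownClosed Small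
  small-down r≤s s≤s* = trans r≤s (trans s≤s* (*-antitone r≤s))

  coSmall-upward : ∀ {x y} → x ≤ y → CoSmall x → CoSmall y
  coSmall-upward x≤y x*≤x = trans (*-antitone x≤y) (trans x*≤x x≤y)

  -- With w = (u ∧ x*) ∨ v ∨ x, w* lies below x*, v* and u* ∨ x, so that it is
  -- the join of w* ∧ u* ≤ (u ∨ v)* ≤ u ∨ v and w* ∧ x ≤ x.
  coSmall-shift : ∀ {u v x} → CoSmall (u ∨ v) → CoSmall (u ∧ x * ∨ v ∨ x)
  coSmall-shift {u} {v} {x} cs =
    trans (∧-greatest refl w*≤u*∨x) (trans (reflexive (∧-distribˡ-∨ _ _ _)) (∨-least
      (trans (∧-greatest (trans (x∧y≤x _ _) w*≤x*) w*∧u*≤u∨v)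
        (trans (reflexive (∧-distribˡ-∨ _ _ _)) (∨-least
          (trans (∧-greatest (x∧y≤y _ _) (x∧y≤x _ _)) (x≤x∨y _ _))
          (trans (x∧y≤y _ _) y≤x∨[y∨z]))))
      (trans (x∧y≤y _ _) z≤x∨[y∨z])))
    where
    w = u ∧ x * ∨ v ∨ x

    w*≤x* : w * ≤ x *
    w*≤x* = *-antitone z≤x∨[y∨z]

    w*≤u*∨x : w * ≤ u * ∨ x
    w*≤u*∨x = trans (*-antitone (x≤x∨y _ _))
      (trans (reflexive deMorgan-∧) (∨-monotonic refl x**≤x))

    w*∧u*≤u∨v : w * ∧ u * ≤ u ∨ v
    w*∧u*≤u∨v = trans
      (∧-greatest (x∧y≤y _ _) (trans (x∧y≤x _ _) (*-antitone y≤x∨[y∨z])))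
      (trans (reflexive (Eq.sym deMorgan-∨)) cs)

  -- Star triples and derivations.

  record StarTriple (r s t : Carrier) : Set ℓ where
    field
      r≤s*    : r ≤ s *
      r≤t*    : r ≤ t *
      s≤t*    : s ≤ t *
      coSmall : CoSmall (r ∨ s ∨ t)

  -- A node of a derivation singles out the third element of its triple as the edge to the root;
  -- permuting the triple allows rerooting.
  starTriple-rotate : ∀ {r s t} → StarTriple r s t → StarTriple s t r
  starTriple-rotate star = record
    { r≤s*    = s≤t*
    ; r≤t*    = ≤*-swap r≤s*
    ; s≤t*    = ≤*-swap r≤t*
    ; coSmall = coSmall-upward ∨-rotate coSmall
    }
    where open StarTriple star

  starTriple-swap : ∀ {r s t} → StarTriple r s t → StarTriple r t s
  starTriple-swap star = record
    { r≤s*    = r≤t*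
    ; r≤t*    = r≤s*
    ; s≤t*    = ≤*-swap s≤t*
    ; coSmall = coSmall-upward (∨-monotonic refl (∨-least (y≤x∨y _ _) (x≤x∨y _ _))) coSmall
    }
    where open StarTriple star

  -- A derivation of u is an S-tree with one edge pointing to a distinguished
  -- leaf, labelled u, all of whose other nodes have their stars in 𝓣* ∪ 𝓕 Q.
  -- The stars of StarTriple are nested even where two of their elements
  -- coincide; this loses nothing once Q contains the small separations.
  data Derivable (S Q : Subset) : Carrier → Set ℓ where
    leaf : ∀ {t} → t ∈ S → t ∈ Q → Derivable S Q t
    node : ∀ {r s t u} → StarTriple r s t → t ∈ S →
           Derivable S Q r → Derivable S Q s → u ≈ t * → Derivable S Q u

  -- The two derivations are the halves of an S-tree cut at an edge labelled `s`.
  Contradictory : (S Q : Subset) → Set ℓ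
  Contradictory S Q = ∃[ s ] (Derivable S Q s × Derivable S Q (s *))

  infixl 5 _⊕_
  _⊕_ : Subset → Carrier → Subset
  (Q ⊕ s) x = x ∈ Q ⊎ x ≤ s

  ⊕-downClosed : ∀ {Q s} → DownClosed Q → DownClosed (Q ⊕ s)
  ⊕-downClosed down r≤s (inj₁ s∈Q) = inj₁ (down r≤s s∈Q)
  ⊕-downClosed down r≤s (inj₂ s≤x) = inj₂ (trans r≤s s≤x)

  -- Derivations are finite: `l` and `k` collect what is used of `S` and `Q`. This yields
  -- monotonicity, the restriction to finite subsystems and the passage to unions of chains.
  support : ∀ {S Q t} → Derivable S Q t →
    ∃[ l ] ∃[ k ] (All (_∈ S) l × All (_∈ Q) k ×
      (∀ S′ Q′ → All (_∈ S′) l → All (_∈ Q′) k → Derivable S′ Q′ t))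
  support (leaf {t} t∈S t∈Q) = t ∷ [] , t ∷ [] , t∈S ∷ [] , t∈Q ∷ [] ,
    λ { _ _ (t∈S′ ∷ []) (t∈Q′ ∷ []) → leaf t∈S′ t∈Q′ }
  support (node {t = t} star t∈S d e u≈t*)
    with l , k , l⊆S , k⊆Q , d′ ← support d
       | m , n , m⊆S , n⊆Q , e′ ← support e
    = t ∷ l ++ m , k ++ n , t∈S ∷ ++⁺ l⊆S m⊆S , ++⁺ k⊆Q n⊆Q ,
      λ { S′ Q′ (t∈S′ ∷ lm) kn → node star t∈S′
            (d′ S′ Q′ (++⁻ˡ l lm) (++⁻ˡ k kn)) (e′ S′ Q′ (++⁻ʳ l lm) (++⁻ʳ k kn)) u≈t* }

  contradictory-support : ∀ {S Q} → Contradictory S Q →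
    ∃[ l ] ∃[ k ] (All (_∈ S) l × All (_∈ Q) k ×
      (∀ S′ Q′ → All (_∈ S′) l → All (_∈ Q′) k → Contradictory S′ Q′))
  contradictory-support (s , d , e)
    with l , k , l⊆S , k⊆Q , d′ ← support d
       | m , n , m⊆S , n⊆Q , e′ ← support e
    = l ++ m , k ++ n , ++⁺ l⊆S m⊆S , ++⁺ k⊆Q n⊆Q ,
      λ S′ Q′ lm kn → s , d′ S′ Q′ (++⁻ˡ l lm) (++⁻ˡ k kn) , e′ S′ Q′ (++⁻ʳ l lm) (++⁻ʳ k kn)

  contradictory-mono : ∀ {S S′ Q Q′} → S ⊆ S′ → Q ⊆ Q′ →
    Contradictory S Q → Contradictory S′ Q′
  contradictory-mono S⊆S′ Q⊆Q′ c with l , k , l⊆S , k⊆Q , c′ ← contradictory-support c =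
    c′ _ _ (All.map S⊆S′ l⊆S) (All.map Q⊆Q′ k⊆Q)

  -- Only the smaller element must lie in `S`, since `cut-acc` descends from separations that need
  -- not belong to it.
  Below : Subset → Rel Carrier ℓ
  Below S x y = x ∈ S × x ≤ y × ¬ y ≤ x

  -- The first is what `shift` needs: for a label `y ≤ a *`, the inverse of `y ∧ x *` is `x ∨ y *`,
  -- the join of `x` with an element above `a`. The second is its mirror image under the involution.
  EmulatesAbove EmulatesBelow : Subset → Carrier → Subset
  EmulatesAbove S a x = ∀ {t} → t ∈ S → a ≤ t → (x ∨ t) ∈ S
  EmulatesBelow S b x = ∀ {t} → t ∈ S → t ≤ b → (x ∧ t) ∈ S

  -- Rerooting and shifting trees.

  module System {S : Subset} (isSystem : IsSystem S) where
    open IsSystem isSystem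

    *∈S : ∀ {s} → s * ∈ S → s ∈ S
    *∈S s*∈S = respects (*-involutive _) (*-closed s*∈S)

    derivable-∈S : ∀ {Q t} → Derivable S Q t → t ∈ S
    derivable-∈S (leaf t∈S _)          = t∈S
    derivable-∈S (node _ t∈S _ _ u≈t*) = respects (Eq.sym u≈t*) (*-closed t∈S)

    derivable-resp : ∀ {Q} → DownClosed Q → Derivable S Q Respects _≈_
    derivable-resp down x≈y (leaf x∈S x∈Q) =
      leaf (respects x≈y x∈S) (down (reflexive (Eq.sym x≈y)) x∈Q)
    derivable-resp down x≈y (node star t∈S d e u≈t*) =
      node star t∈S d e (Eq.trans (Eq.sym x≈y) u≈t*)

    module _ {Q a} (down : DownClosed Q) (small : Small ⊆ Q)
      (below : ∀ {x} → Below S x a → x ∈ Q) (a∉Q : a ∉ Q) where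

      -- As a is not small, no tree over nested stars has two leaves labelled a;
      -- if it has one, it can be rerooted there.
      remove-leaf : ∀ {t} → Derivable S (Q ⊕ a) t →
        Derivable S Q t ⊎ (a ≤ t × (Derivable S Q (t *) → Derivable S Q (a *)))
      remove-leaf (leaf t∈S (inj₁ t∈Q)) = inj₁ (leaf t∈S t∈Q)
      remove-leaf {t} (leaf t∈S (inj₂ t≤a)) with em {a ≤ t}
      ... | yes a≤t = inj₂ (a≤t , derivable-resp down (*-cong (antisym t≤a a≤t)))
      ... | no a≰t  = inj₁ (leaf t∈S (below (t∈S , t≤a , a≰t)))
      remove-leaf {u} (node {r} {s} {t} star t∈S d e u≈t*) with remove-leaf d | remove-leaf e
      ... | inj₁ d′        | inj₁ e′        = inj₁ (node star t∈S d′ e′ u≈t*)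
      ... | inj₁ d′        | inj₂ (a≤s , g) =
        inj₂ ( trans a≤s (trans (StarTriple.s≤t* star) (reflexive (Eq.sym u≈t*)))
             -- `f` derives `u *`, which is `t`. Together with `d′` it derives `s *` at the same
             -- node, and `g` carries this on to the leaf labelled `a`.
             , λ f → g (node (starTriple-swap star) (derivable-∈S e) d′ (derivable-resp down
                 (Eq.trans (*-cong u≈t*) (*-involutive t)) f) Eq.refl))
      ... | inj₂ (a≤r , g) | inj₁ e′        =
        inj₂ ( trans a≤r (trans (StarTriple.r≤t* star) (reflexive (Eq.sym u≈t*)))
             , λ f → g (node (starTriple-rotate star) (derivable-∈S d) e′ (derivable-resp down
                 (Eq.trans (*-cong u≈t*) (*-involutive t)) f) Eq.refl))
      ... | inj₂ (a≤r , _) | inj₂ (a≤s , _) =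
        ⊥-elim (a∉Q (small (trans a≤r (trans (StarTriple.r≤s* star) (*-antitone a≤s)))))

      -- At most one half has a leaf labelled `a`, since `a ≤ t` and `a ≤ t *` would make `a` small.
      -- Rooting the whole tree at this leaf derives `a *`.
      contradictory-remove-leaf : Contradictory S (Q ⊕ a) → Contradictory S Q ⊎ Derivable S Q (a *)
      contradictory-remove-leaf (t , d , e) with remove-leaf d | remove-leaf e
      ... | inj₁ d′        | inj₁ e′         = inj₁ (t , d′ , e′)
      ... | inj₁ d′        | inj₂ (_ , g)    =
        inj₂ (g (derivable-resp down (Eq.sym (*-involutive t)) d′))
      ... | inj₂ (_ , g)   | inj₁ e′         = inj₂ (g e′)
      ... | inj₂ (a≤t , _) | inj₂ (a≤t* , _) = ⊥-elim (a∉Q (small (trans a≤t (≤*-swap a≤t*))))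

    -- Every label pointing towards the root is met with `x *`. All of them stay below `a *`, so the
    -- new labels lie in `S`; leaves stay in `Q` by down-closure, and `coSmall-shift` preserves the
    -- stars.
    shift : ∀ {Q a x y} → DownClosed Q → EmulatesAbove S a x →
      Derivable S Q y → y ≤ a * → Derivable S Q (y ∧ x *)
    shift down emulates (leaf y∈S y∈Q) y≤a* = leaf
      (*∈S (respects (Eq.sym [x∧y*]*≈y∨x*) (emulates (*-closed y∈S) (≤*-swap y≤a*))))
      (down (x∧y≤x _ _) y∈Q)
    shift {x = x} down emulates (node {r} {s} {t} star t∈S d e y≈t*) y≤a* =
      node shifted (emulates t∈S (*-cancel-≤ t*≤a*))
        (shift down emulates d (trans r≤t* t*≤a*))
        (shift down emulates e (trans s≤t* t*≤a*))
        (antisym (below (reflexive y≈t*)) (trans (reflexive deMorgan-∨)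
          (∧-greatest (trans (x∧y≤y _ _) (reflexive (Eq.sym y≈t*))) (x∧y≤x _ _))))
      where
      open StarTriple star
      t*≤a* = trans (reflexive (Eq.sym y≈t*)) y≤a*

      below : ∀ {z} → z ≤ t * → z ∧ x * ≤ (x ∨ t) *
      below z≤t* = trans (∧-greatest (x∧y≤y _ _) (trans (x∧y≤x _ _) z≤t*))
                         (reflexive (Eq.sym deMorgan-∨))

      shifted : StarTriple (r ∧ x *) (s ∧ x *) (x ∨ t)
      shifted = record
        { r≤s*    = trans (x∧y≤x _ _) (trans r≤s* (*-antitone (x∧y≤x _ _)))
        ; r≤t*    = below r≤t*
        ; s≤t*    = below s≤t*
        ; coSmall = coSmall-upward
            (∨-least (trans (reflexive (∧-distribʳ-∨ _ _ _)) (∨-monotonic refl (x≤x∨y _ _)))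
                     (∨-least (trans (y≤x∨y _ _) z≤x∨[y∨z]) (trans (x≤x∨y _ _) z≤x∨[y∨z])))
            (coSmall-shift {r ∨ s} {t} {x} (coSmall-upward
               (∨-least (trans (x≤x∨y _ _) (x≤x∨y _ _)) (∨-monotonic (y≤x∨y _ _) refl)) coSmall))
        }

    -- From derivations to S-trees.

    data LTree : ∀ {n} → Parents n → Set ℓ where
      root : LTree root
      grow : ∀ {n} {P : Parents n} → LTree P → ∀ p {a} → a ∈ S → LTree (grow P p)

    label : ∀ {n} {P : Parents n} → LTree P → ∀ x y → T (adjacent P x y) → Carrier
    label (grow L p {a} _) zero    (suc j) _ = a
    label (grow L p {a} _) (suc i) zero    _ = a *
    label (grow L p _)     (suc i) (suc j) e = label L i j e

    label-∈ : ∀ {n} {P : Parents n} (L : LTree P) x y (e : T (adjacent P x y)) → label L x y e ∈ S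
    label-∈ (grow L p a∈S) zero    (suc j) _ = a∈S
    label-∈ (grow L p a∈S) (suc i) zero    _ = *-closed a∈S
    label-∈ (grow L p _)   (suc i) (suc j) e = label-∈ L i j e

    label-sym : ∀ {n} {P : Parents n} (L : LTree P) x y (e : T (adjacent P x y)) →
      label L y x (adjacent-sym P x y e) ≈ label L x y e *
    label-sym (grow L p a∈S) zero    (suc j) _ = Eq.refl
    label-sym (grow L p a∈S) (suc i) zero    _ = Eq.sym (*-involutive _)
    label-sym (grow L p _)   (suc i) (suc j) e = label-sym L i j e

    sTreeOf : ∀ {n} {P : Parents n} → LTree P → STree S
    sTreeOf {P = P} L = record
      { tree  = treeOf P
      ; α     = λ {x} {y} → label L x y
      ; α-∈   = λ {x} {y} → label-∈ L x y
      ; α-sym = λ {x} {y} → label-sym L x y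
      }

    In : ∀ {n} {P : Parents n} → LTree P → Fin n → Subset
    In L = STree.αF (sTreeOf L)

    module _ {n} {P : Parents n} (L : LTree P) (p : Fin n) {a} (a∈S : a ∈ S) where
      in-new : In (grow L p a∈S) zero ≐ ｛ a * ｝
      in-new = (λ { (suc j , e , x≈) → x≈ }) , λ x≈ → suc p , fromWitness ≡.refl , x≈

      in-parent : In (grow L p a∈S) (suc p) ≐ In L p ∪ ｛ a ｝
      in-parent = (λ { (zero , e , x≈) → inj₂ x≈ ; (suc j , e , x≈) → inj₁ (j , e , x≈) })
                , λ { (inj₁ (j , e , x≈)) → suc j , e , x≈
                    ; (inj₂ x≈)           → zero , fromWitness ≡.refl , x≈ }

      in-other : ∀ {x} → x ≢ p → In (grow L p a∈S) (suc x) ≐ In L x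
      in-other x≢p = (λ { (zero  , e , x≈) → ⊥-elim (x≢p (toWitness e))
                        ; (suc j , e , x≈) → j , e , x≈ })
                   , λ { (j , e , x≈) → suc j , e , x≈ }

    module Trees (F : Family) (F-resp : ∀ {X Y} → X ≐ Y → X ∈ F → Y ∈ F) {Q : Subset}
      (F-leaf : ∀ {t} → t ∈ S → t ∈ Q → ｛ t * ｝ ∈ F)
      (F-star : ∀ {r s t} → r ∈ S → s ∈ S → t ∈ S → StarTriple r s t → ｛_,_,_｝ r s t ∈ F) where

      -- L is a subtree of tree, only the star at q changes, to a member of G, and
      -- the stars at all added nodes are in F.
      record Extension {n} {P : Parents n} (L : LTree P) (q : Fin n) (G : Family) : Set ℓ where
        field
          {size}      : ℕ
          {parents}   : Parents size
          tree        : LTree parents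
          ι           : Fin n → Fin size
          ι-injective : Injective _≡_ _≡_ ι
          at          : In tree (ι q) ∈ G
          other       : ∀ {x} → x ≢ q → In tree (ι x) ≐ In L x
          added       : ∀ y → In tree y ∈ F ⊎ ∃[ x ] y ≡ ι x
      open Extension

      weaken : ∀ {n} {P : Parents n} {L : LTree P} {q G H} → (∀ {X} → X ∈ G → X ∈ H) →
        Extension L q G → Extension L q H
      weaken G⊆H E = record
        { tree  = tree E ; ι = ι E ; ι-injective = ι-injective E ; at = G⊆H (at E)
        ; other = other E ; added = added E }

      compose : ∀ {n} {P : Parents n} {L : LTree P} {q G H} (E : Extension L q G) →
        Extension (tree E) (ι E q) H → Extension L q H
      compose {L = L} {q} E E′ = record
        { tree        = tree E′
        ; ι           = ι E′ ∘ ι E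
        ; ι-injective = ι-injective E ∘ ι-injective E′
        ; at          = at E′
        ; other       = λ x≢q → ≐-trans (other E′ (x≢q ∘ ι-injective E)) (other E x≢q)
        ; added       = added′
        }
        where
        added′ : ∀ y → In (tree E′) y ∈ F ⊎ ∃[ x ] y ≡ ι E′ (ι E x)
        added′ y with added E′ y
        ... | inj₁ ∈F = inj₁ ∈F
        -- A node coming from `E` other than the one completed by `E′` keeps the star it has there.
        ... | inj₂ (x , ≡.refl) with x ≟ ι E q
        ...   | yes ≡.refl = inj₂ (q , ≡.refl)
        ...   | no x≢ιq with added E x
        ...     | inj₁ ∈F           = inj₁ (F-resp (≐-sym (other E′ x≢ιq)) ∈F)
        ...     | inj₂ (z , ≡.refl) = inj₂ (z , ≡.refl)

      -- A new leaf is grown at `q` and then completed. Only the growing step changes the star at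
      -- `q`, and the leaf counts as an added node afterwards.
      branch : ∀ {n} {P : Parents n} {L : LTree P} {q r} (r∈S : r ∈ S) →
        Extension (grow L q r∈S) zero F → Extension L q (_≐ (In L q ∪ ｛ r ｝))
      branch {L = L} {q} r∈S E = record
        { tree        = tree E
        ; ι           = ι E ∘ suc
        ; ι-injective = suc-injective ∘ ι-injective E
        ; at          = ≐-trans (other E λ ()) (in-parent L q r∈S)
        ; other       = λ x≢q → ≐-trans (other E λ ()) (in-other L q r∈S x≢q)
        ; added       = added′
        }
        where
        added′ : ∀ y → In (tree E) y ∈ F ⊎ ∃[ x ] y ≡ ι E (suc x)
        added′ y with added E y
        ... | inj₁ ∈F               = inj₁ ∈F
        ... | inj₂ (zero  , ≡.refl) = inj₁ (at E)
        ... | inj₂ (suc x , y≡ιx)   = inj₂ (x , y≡ιx)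

      -- So far `q` is a leaf, with the inverse of the root label as its only incoming label. In the
      -- node case the subtrees for `r` and `s` are hung at `q` in turn; as `u * ≈ t`, its star
      -- becomes that of the triple.
      complete : ∀ {n} {P : Parents n} (L : LTree P) q {t} → In L q ≐ ｛ t * ｝ →
        Derivable S Q t → Extension L q F
      complete L q In≐ (leaf t∈S t∈Q) = record
        { tree = L ; ι = id ; ι-injective = id ; at = F-resp (≐-sym In≐) (F-leaf t∈S t∈Q)
        ; other = λ _ → id , id ; added = λ y → inj₂ (y , ≡.refl) }
      complete L q {u} In≐ (node {r} {s} {t} star t∈S d e u≈t*) =
        weaken (λ X≐ → F-resp (≐-sym (≐-trans X≐ rst)) (F-star r∈S s∈S t∈S star)) (compose E₁ E₂)
        where
        r∈S = derivable-∈S d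
        s∈S = derivable-∈S e

        E₁ : Extension L q (_≐ (In L q ∪ ｛ r ｝))
        E₁ = branch r∈S (complete (grow L q r∈S) zero (in-new L q r∈S) d)

        E₂ : Extension (tree E₁) (ι E₁ q) (_≐ (In (tree E₁) (ι E₁ q) ∪ ｛ s ｝))
        E₂ = branch s∈S (complete (grow (tree E₁) (ι E₁ q) s∈S) zero (in-new _ _ s∈S) e)

        u*≈t : u * ≈ t
        u*≈t = Eq.trans (*-cong u≈t*) (*-involutive t)

        rst : (In (tree E₁) (ι E₁ q) ∪ ｛ s ｝) ≐ ｛_,_,_｝ r s t
        rst = [ [ (λ x∈ → inj₂ (inj₂ (Eq.trans (proj₁ In≐ x∈) u*≈t))) , inj₁ ]′ ∘ proj₁ (at E₁)
              , inj₂ ∘ inj₁ ]′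
            , [ inj₁ ∘ proj₂ (at E₁) ∘ inj₂
              , [ inj₂
                , (λ x≈t → inj₁ (proj₂ (at E₁) (inj₁ (proj₂ In≐ (Eq.trans x≈t (Eq.sym u*≈t))))))
                ]′ ]′

      -- Growing `d` from a single node gives this node the one incoming label `s`, that is `s * *`.
      -- So it is a leaf at which `e` can be grown.
      contradictory⇒tree : Contradictory S Q → HasSTreeOver S F
      contradictory⇒tree (s , d , e) = sTreeOf (tree E) , over
        where
        s∈S = derivable-∈S d

        E₁ : Extension root zero (_≐ (In root zero ∪ ｛ s ｝))
        E₁ = branch s∈S (complete (grow root zero s∈S) zero (in-new root zero s∈S) d)

        s≐s** : (In root zero ∪ ｛ s ｝) ≐ ｛ s * * ｝
        s≐s** = (λ { (inj₂ x≈s) → Eq.trans x≈s (Eq.sym (*-involutive s)) })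
              , λ x≈s** → inj₂ (Eq.trans x≈s** (*-involutive s))

        E : Extension root zero F
        E = compose E₁ (complete (tree E₁) (ι E₁ zero) (≐-trans (at E₁) s≐s**) e)

        over : ∀ y → In (tree E) y ∈ F
        over y with added E y
        ... | inj₁ ∈F               = ∈F
        ... | inj₂ (zero , ≡.refl) = at E

  -- Uncrossing by submodularity.

  module SubmodularSystem {S : Subset} (isSystem : IsSystem S) (submodular : Submodular S) where
    open IsSystem isSystem
    open System isSystem

    -- Submodularity is applied to `r` and `s *`. In the first case `s` shrinks to `s ∧ r *`, in the
    -- second `r` shrinks to `r ∧ s *`; `coSmall-shift` restores what is lost.
    uncross₂ : ∀ {r s c} → r ∈ S → s ∈ S → CoSmall (r ∨ s ∨ c) →
      ∃[ r′ ] ∃[ s′ ] (r′ ∈ S × s′ ∈ S × r′ ≤ r × s′ ≤ s × r′ ≤ s′ * × CoSmall (r′ ∨ s′ ∨ c))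
    uncross₂ {r} {s} {c} r∈S s∈S cs with submodular r∈S (*-closed s∈S)
    ... | inj₁ r∨s*∈S =
      r , s ∧ r * , r∈S , *∈S (respects (Eq.sym [x∧y*]*≈y∨x*) r∨s*∈S) ,
      refl , x∧y≤x _ _ , trans x≤x** (*-antitone (x∧y≤y _ _)) ,
      coSmall-upward (∨-least y≤x∨[y∨z] (∨-least (∨-least (x≤x∨y _ _) z≤x∨[y∨z]) (x≤x∨y _ _)))
        (coSmall-shift {s} {r ∨ c} {r}
          (coSmall-upward (∨-least y≤x∨[y∨z] (∨-monotonic refl (y≤x∨y _ _))) cs))
    ... | inj₂ r∧s*∈S =
      r ∧ s * , s , r∧s*∈S , s∈S , x∧y≤x _ _ , refl , x∧y≤y _ _ ,
      coSmall-upward (∨-monotonic refl (∨-least refl (x≤x∨y _ _)))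
        (coSmall-shift {r} {s ∨ c} {s} cs)

    -- The three pairs are uncrossed in turn. Later steps only shrink separations, which keeps
    -- earlier pairs nested.
    uncross₃ : ∀ {r s t} → r ∈ S → s ∈ S → t ∈ S → CoSmall (r ∨ s ∨ t) →
      ∃[ r′ ] ∃[ s′ ] ∃[ t′ ]
        (r′ ∈ S × s′ ∈ S × t′ ∈ S × r′ ≤ r × s′ ≤ s × t′ ≤ t × StarTriple r′ s′ t′)
    uncross₃ r∈S s∈S t∈S cs
      with r₁ , s₁ , r₁∈S , s₁∈S , r₁≤r , s₁≤s , r₁≤s₁* , cs₁ ← uncross₂ r∈S s∈S cs
      with s₂ , t₁ , s₂∈S , t₁∈S , s₂≤s₁ , t₁≤t , s₂≤t₁* , cs₂
        ← uncross₂ s₁∈S t∈S (coSmall-upward ∨-rotate cs₁)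
      with t₂ , r₂ , t₂∈S , r₂∈S , t₂≤t₁ , r₂≤r₁ , t₂≤r₂* , cs₃
        ← uncross₂ t₁∈S r₁∈S (coSmall-upward ∨-rotate cs₂)
      = r₂ , s₂ , t₂ , r₂∈S , s₂∈S , t₂∈S ,
        trans r₂≤r₁ r₁≤r , trans s₂≤s₁ s₁≤s , trans t₂≤t₁ t₁≤t , record
        { r≤s* = trans r₂≤r₁ (trans r₁≤s₁* (*-antitone s₂≤s₁))
        ; r≤t* = ≤*-swap t₂≤r₂*
        ; s≤t* = trans s₂≤t₁* (*-antitone t₂≤t₁)
        ; coSmall = coSmall-upward ∨-rotate cs₃
        }

    -- Interpolation, and cutting in the well-founded case.

    module _ (wf : WellFounded (Below S)) where
      Interpolant : Carrier → Carrier → Subset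
      Interpolant a b x = x ∈ S × a ≤ x × x ≤ b × EmulatesAbove S a x × EmulatesBelow S b x

      -- Starting from a, replace x by x ∨ m for a minimal m ≤ b with x ∧ m ∉ S.
      -- For t ≥ a in S, either m ∨ (x ∨ t) lies in S, or m ∧ (x ∨ t) does and then
      -- m ≤ x ∨ t by minimality; so x ∨ m still emulates a.
      interpolate : ∀ {a b} → a ∈ S → a ≤ b → ∃[ x ] x ∈ Interpolant a b
      interpolate {a} {b} a∈S a≤b =
        go a (wf (a *)) a∈S refl a≤b λ t∈S a≤t → respects (Eq.sym (x≤y⇒x∨y≈y a≤t)) t∈S
        where
        Bad : Carrier → Subset
        Bad x y = y ∈ S × y ≤ b × ¬ (x ∧ y) ∈ S

        go : ∀ x → Acc (Below S) (x *) → x ∈ S → a ≤ x → x ≤ b → EmulatesAbove S a x →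
          ∃[ x ] x ∈ Interpolant a b
        go x (acc rs) x∈S a≤x x≤b emulates with em {∃[ y ] y ∈ Bad x}
        ... | no good = x , x∈S , a≤x , x≤b , emulates , λ y∈S y≤b →
          decidable-stable em λ x∧y∉S → good (_ , y∈S , y≤b , x∧y∉S)
        ... | yes (y , bad)
          with m , (m∈S , m≤b , x∧m∉S) , least ← minimal em {P = Bad x} (wf y) bad =
          go (x ∨ m)
             -- Recursion descends along inverses. The join is strictly above `x`, since `m ≤ x`
             -- would make `x ∧ m` equal to `m` and hence a member of `S`.
             (rs ( *-closed x∨m∈S , *-antitone (x≤x∨y _ _)
                 , λ x*≤[x∨m]* → x∧m∉S (respects (antisym
                     (∧-greatest (trans (y≤x∨y _ _) (*-cancel-≤ x*≤[x∨m]*)) refl) (x∧y≤y _ _)) m∈S)))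
             x∨m∈S (trans a≤x (x≤x∨y _ _)) (∨-least x≤b m≤b) emulates′
          where
          x∨m∈S : (x ∨ m) ∈ S
          x∨m∈S = [ id , (λ x∧m∈S → ⊥-elim (x∧m∉S x∧m∈S)) ]′ (submodular x∈S m∈S)

          emulates′ : EmulatesAbove S a (x ∨ m)
          emulates′ {t} t∈S a≤t with submodular m∈S (emulates t∈S a≤t)
          ... | inj₁ ∈S = respects (antisym
            (∨-least (trans (y≤x∨y _ _) (x≤x∨y _ _)) (∨-monotonic (x≤x∨y _ _) refl))
            (∨-least (∨-least y≤x∨[y∨z] (x≤x∨y _ _)) z≤x∨[y∨z])) ∈S
          ... | inj₂ ∈S = respects (antisym
                (∨-monotonic (x≤x∨y _ _) refl)
                (∨-least (∨-least (x≤x∨y _ _) m≤x∨t) (y≤x∨y _ _)))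
              (emulates t∈S a≤t)
            where
            -- By absorption, meeting this element with `x` gives `x ∧ m` again.
            still-bad : Bad x (m ∧ (x ∨ t))
            still-bad = ∈S , trans (x∧y≤x _ _) m≤b , λ x∧[m∧[x∨t]]∈S → x∧m∉S (respects (antisym
              (∧-monotonic refl (x∧y≤x _ _))
              (∧-greatest (x∧y≤x _ _) (∧-greatest (x∧y≤y _ _) (trans (x∧y≤x _ _) (x≤x∨y _ _)))))
              x∧[m∧[x∨t]]∈S)

            m≤x∨t : m ≤ x ∨ t
            m≤x∨t = trans
              (decidable-stable em λ m≰ → least still-bad (∈S , x∧y≤x _ _ , m≰)) (x∧y≤y _ _)

      -- For an interpolant `x` between `a` and `b *`, the shifted root labels fit together:
      -- `a * ∧ x *` is `x *`, and `b * ∧ x * *` is `x`.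
      merge : ∀ {Q a b} → DownClosed Q → a ≤ b * →
        Derivable S Q (a *) → Derivable S Q (b *) → Contradictory S Q
      merge {Q} {a} {b} down a≤b* d e
        with x , x∈S , a≤x , x≤b* , emulates-a , emulates-b
            ← interpolate (*∈S (derivable-∈S d)) a≤b* =
          x
        , derivable-resp down
            (Eq.trans (antisym (x∧y≤y _ _) (∧-greatest (trans x**≤x x≤b*) refl)) (*-involutive x))
            (shift down emulates-b* e refl)
        , derivable-resp down
            (antisym (x∧y≤y _ _) (∧-greatest (*-antitone a≤x) refl))
            (shift down emulates-a d refl)
        where
        emulates-b* : EmulatesAbove S b (x *)
        emulates-b* t∈S b≤t = respects
          (Eq.trans deMorgan-∧ (∨-cong Eq.refl (*-involutive _)))
          (*-closed (emulates-b (*-closed t∈S) (*-antitone b≤t)))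

      -- `R` varies because several elements are added at once and removed one after another, the
      -- earlier ones still being present.
      Removable : Subset → Carrier → Set (lsuc ℓ)
      Removable Q z = ∀ R → DownClosed R → Q ⊆ R → Contradictory S (R ⊕ z) → Contradictory S R

      -- By induction on the list: the bound `z` of the head is added to `R`, the tail is treated
      -- over this larger set, and then `z` is removed.
      remove-all : ∀ {Q} k → All (λ x → x ∈ Q ⊎ ∃[ z ] (x ≤ z × Removable Q z)) k →
        ∀ R → DownClosed R → Q ⊆ R →
        (∀ R′ → R ⊆ R′ → All (_∈ R′) k → Contradictory S R′) → Contradictory S R
      remove-all [] [] R _ Q⊆R contr = contr R id []
      remove-all (x ∷ k) (inj₁ x∈Q ∷ ps) R downR Q⊆R contr =
        remove-all k ps R downR Q⊆R λ R′ R⊆R′ k⊆R′ → contr R′ R⊆R′ (R⊆R′ (Q⊆R x∈Q) ∷ k⊆R′)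
      remove-all (x ∷ k) (inj₂ (z , x≤z , removable) ∷ ps) R downR Q⊆R contr =
        removable R downR Q⊆R (remove-all k ps (R ⊕ z) (⊕-downClosed downR) (inj₁ ∘ Q⊆R)
          λ R′ R⊕z⊆R′ k⊆R′ → contr R′ (R⊕z⊆R′ ∘ inj₁) (R⊕z⊆R′ (inj₂ x≤z) ∷ k⊆R′))

      -- Adding to Q everything strictly below a or b makes a and b minimal outside
      -- Q, so that each can be removed from its tree down to a single leaf; what was
      -- added is then removed again by induction.
      cut-acc : ∀ {a b} → Acc (Below S) a → Acc (Below S) b → a ≤ b * →
        ∀ Q → DownClosed Q → Small ⊆ Q →
        Contradictory S (Q ⊕ a) → Contradictory S (Q ⊕ b) → Contradictory S Q
      cut-acc {a} {b} (acc as) (acc bs) a≤b* Q down small contr-a contr-b =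
        let _ , k , l⊆S , k⊆Q⁺ , contr = contradictory-support contr⁺ in
        remove-all k (All.map removable k⊆Q⁺) Q down id λ R′ _ k⊆R′ → contr S R′ l⊆S k⊆R′
        where
        Q⁺ : Subset
        Q⁺ x = x ∈ Q ⊎ ∃[ z ] ((Below S z a ⊎ Below S z b) × x ≤ z)

        down⁺ : DownClosed Q⁺
        down⁺ r≤s (inj₁ s∈Q)              = inj₁ (down r≤s s∈Q)
        down⁺ r≤s (inj₂ (z , z<ab , s≤z)) = inj₂ (z , z<ab , trans r≤s s≤z)

        contr⁺ : Contradictory S Q⁺
        contr⁺ with em {a ∈ Q⁺} | em {b ∈ Q⁺}
        -- If `a` is already in `Q⁺`, adding it changes nothing.
        ... | yes a∈Q⁺ | _        =
          contradictory-mono id [ inj₁ , (λ x≤a → down⁺ x≤a a∈Q⁺) ]′ contr-a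
        ... | no _     | yes b∈Q⁺ =
          contradictory-mono id [ inj₁ , (λ x≤b → down⁺ x≤b b∈Q⁺) ]′ contr-b
        ... | no a∉Q⁺  | no b∉Q⁺
          with contradictory-remove-leaf down⁺ (inj₁ ∘ small)
                 (λ x<a → inj₂ (_ , inj₁ x<a , refl)) a∉Q⁺
                 (contradictory-mono id (⊎-map₁ inj₁) contr-a)
             | contradictory-remove-leaf down⁺ (inj₁ ∘ small)
                 (λ x<b → inj₂ (_ , inj₂ x<b , refl)) b∉Q⁺
                 (contradictory-mono id (⊎-map₁ inj₁) contr-b)
        ...   | inj₁ c | _      = c
        ...   | inj₂ _ | inj₁ c = c
        ...   | inj₂ d | inj₂ e = merge down⁺ a≤b* d e

        removable : ∀ {x} → x ∈ Q⁺ → x ∈ Q ⊎ ∃[ z ] (x ≤ z × Removable Q z)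
        removable (inj₁ x∈Q) = inj₁ x∈Q
        removable (inj₂ (z , inj₁ z<a@(_ , z≤a , _) , x≤z)) =
          inj₂ (z , x≤z , λ R downR Q⊆R contr-z →
            cut-acc (as z<a) (acc bs) (trans z≤a a≤b*) R downR (Q⊆R ∘ small)
              contr-z (contradictory-mono id (⊎-map₁ Q⊆R) contr-b))
        removable (inj₂ (z , inj₂ z<b@(_ , z≤b , _) , x≤z)) =
          inj₂ (z , x≤z , λ R downR Q⊆R contr-z →
            cut-acc (acc as) (bs z<b) (trans a≤b* (*-antitone z≤b)) R downR (Q⊆R ∘ small)
              (contradictory-mono id (⊎-map₁ Q⊆R) contr-a) contr-z)

      cut-wf : ∀ {s} Q → DownClosed Q → Small ⊆ Q →
        Contradictory S (Q ⊕ s) → Contradictory S (Q ⊕ s *) → Contradictory S Q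
      cut-wf {s} = cut-acc (wf s) (wf (s *)) x≤x**

  -- Finite sublattices of a distributive lattice.

  open Membership Eq.setoid using () renaming (_∈_ to _∈ₗ_)

  -- Members of `S` are represented by indices into `L`, and a strict partial order on a finite
  -- index set is well-founded. The starting point may lie outside `S`, so one descent precedes the
  -- passage to indices.
  finite⇒wellFounded : ∀ {S : Subset} L → (∀ {x} → x ∈ S → x ∈ₗ L) → WellFounded (Below S)
  finite⇒wellFounded {S} L S⊆L y = acc λ (z∈S , _) → byIndex (S⊆L z∈S)
    where
    open PosetProperties poset using (<-isStrictPartialOrder) renaming (_<_ to _<ₚ_)

    at : ∀ {i y} → Acc (_<ₚ_ on lookup L) i → y ≈ lookup L i → Acc (Below S) y
    at (acc rs) y≈i = acc λ (z∈S , z≤y , y≰z) →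
      let z≈j = lookup-index (S⊆L z∈S) in
      at (rs ( trans (reflexive (Eq.sym z≈j)) (trans z≤y (reflexive y≈i))
             , λ j≈i → y≰z (reflexive (Eq.trans y≈i (Eq.trans (Eq.sym j≈i) (Eq.sym z≈j)))))) z≈j

    byIndex : ∀ {y} → y ∈ₗ L → Acc (Below S) y
    byIndex y∈L = at
      (FinInduction.spo-wellFounded (On.isStrictPartialOrder (lookup L) <-isStrictPartialOrder) _)
      (lookup-index y∈L)

  Sublattice : List Carrier → Set ℓ
  Sublattice L = ∀ {x y} → x ∈ₗ L → y ∈ₗ L → (x ∨ y) ∈ₗ L × (x ∧ y) ∈ₗ L

  ∈ₗ-resp : ∀ {L x y} → x ≈ y → x ∈ₗ L → y ∈ₗ L
  ∈ₗ-resp = MembershipProperties.∈-resp-≈ Eq.setoid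

  adjoin : Carrier → List Carrier → List Carrier
  adjoin z L = cartesianProductWith (λ a b → a ∨ b ∧ z) L L

  adjoin-∈ : ∀ {z L a b x} → a ∈ₗ L → b ∈ₗ L → x ≈ a ∨ b ∧ z → x ∈ₗ adjoin z L
  adjoin-∈ a∈L b∈L x≈ = ∈ₗ-resp (Eq.sym x≈)
    (MembershipProperties.∈-cartesianProductWith⁺ Eq.setoid Eq.setoid Eq.setoid
      (λ a≈a′ b≈b′ → ∨-cong a≈a′ (∧-cong b≈b′ Eq.refl)) a∈L b∈L)

  adjoin-∋ : ∀ z L {x} → x ∈ₗ adjoin z L → ∃[ a ] ∃[ b ] (a ∈ₗ L × b ∈ₗ L × x ≈ a ∨ b ∧ z)
  adjoin-∋ z L = MembershipProperties.∈-cartesianProductWith⁻ Eq.setoid Eq.setoid Eq.setoid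
    (λ a b → a ∨ b ∧ z) L L

  -- By distributivity, the join of `a ∨ b ∧ z` and `c ∨ d ∧ z` has the coefficients `a ∨ c` and
  -- `b ∨ d`; their meet has `a ∧ c` and `a ∧ d ∨ b ∧ c ∨ b ∧ d`.
  adjoin-sublattice : ∀ z {L} → Sublattice L → Sublattice (adjoin z L)
  adjoin-sublattice z {L} closed x∈ y∈
    with a , b , a∈L , b∈L , x≈ ← adjoin-∋ z L x∈
       | c , d , c∈L , d∈L , y≈ ← adjoin-∋ z L y∈
    = adjoin-∈ (a∈L ∪ₗ c∈L) (b∈L ∪ₗ d∈L)
        (Eq.trans (∨-cong x≈ y≈) (antisym
          (∨-least (∨-monotonic (x≤x∨y _ _) (∧-monotonic (x≤x∨y _ _) refl))
                   (∨-monotonic (y≤x∨y _ _) (∧-monotonic (y≤x∨y _ _) refl)))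
          (∨-least (∨-monotonic (x≤x∨y _ _) (x≤x∨y _ _))
            (trans (reflexive (∧-distribʳ-∨ _ _ _)) (∨-monotonic (y≤x∨y _ _) (y≤x∨y _ _))))))
    , adjoin-∈ (a∈L ∩ₗ c∈L) ((a∈L ∩ₗ d∈L) ∪ₗ ((b∈L ∩ₗ c∈L) ∪ₗ (b∈L ∩ₗ d∈L)))
        (Eq.trans (∧-cong x≈ y≈) (antisym
          (trans (reflexive (∧-distribˡ-∨ _ _ _)) (∨-least
            (trans (reflexive (∧-distribʳ-∨ _ _ _)) (∨-monotonic refl
              (∧-greatest
                (trans (∧-greatest (trans (x∧y≤x _ _) (x∧y≤x _ _)) (x∧y≤y _ _)) y≤x∨[y∨z])
                (trans (x∧y≤x _ _) (x∧y≤y _ _)))))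
            (trans (reflexive (∧-distribʳ-∨ _ _ _)) (∨-least
              (trans (∧-greatest
                (trans (∧-monotonic refl (x∧y≤x _ _)) (x≤x∨y _ _))
                (trans (x∧y≤y _ _) (x∧y≤y _ _))) (y≤x∨y _ _))
              (trans (∧-greatest
                (trans (∧-monotonic (x∧y≤x _ _) (x∧y≤x _ _)) z≤x∨[y∨z])
                (trans (x∧y≤y _ _) (x∧y≤y _ _))) (y≤x∨y _ _))))))
          (∨-least (∧-monotonic (x≤x∨y _ _) (x≤x∨y _ _))
            (trans (reflexive (∧-distribʳ-∨ _ _ _)) (∨-least
              (∧-greatest
                (trans (x∧y≤x _ _) (trans (x∧y≤x _ _) (x≤x∨y _ _)))
                (trans (∧-monotonic (x∧y≤y _ _) refl) (y≤x∨y _ _)))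
              (trans (reflexive (∧-distribʳ-∨ _ _ _)) (∨-least
                (∧-greatest
                  (trans (∧-monotonic (x∧y≤x _ _) refl) (y≤x∨y _ _))
                  (trans (x∧y≤x _ _) (trans (x∧y≤y _ _) (x≤x∨y _ _))))
                (∧-greatest
                  (trans (∧-monotonic (x∧y≤x _ _) refl) (y≤x∨y _ _))
                  (trans (∧-monotonic (x∧y≤y _ _) refl) (y≤x∨y _ _))))))))))
    where
    _∪ₗ_ : ∀ {x y} → x ∈ₗ L → y ∈ₗ L → (x ∨ y) ∈ₗ L
    x∈L ∪ₗ y∈L = proj₁ (closed x∈L y∈L)

    _∩ₗ_ : ∀ {x y} → x ∈ₗ L → y ∈ₗ L → (x ∧ y) ∈ₗ L
    x∈L ∩ₗ y∈L = proj₂ (closed x∈L y∈L)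

  Between : Carrier → Carrier → Carrier → Set ℓ
  Between m M x = m ≤ x × x ≤ M

  bounds : ∀ x l → ∃[ m ] ∃[ M ] All (Between m M) (x ∷ l)
  bounds x [] = x , x , (refl , refl) ∷ []
  bounds x (y ∷ l) with m , M , x∈ ∷ l∈ ← bounds x l =
    m ∧ y , M ∨ y , widen x∈ ∷ (x∧y≤y _ _ , y≤x∨y _ _) ∷ All.map widen l∈
    where
    widen : ∀ {z} → Between m M z → Between (m ∧ y) (M ∨ y) z
    widen (m≤z , z≤M) = trans (x∧y≤x _ _) m≤z , trans z≤M (x≤x∨y _ _)

  adjoin-⊇ : ∀ z {L x} → x ∈ₗ L → x ∈ₗ adjoin z L
  adjoin-⊇ z x∈L = adjoin-∈ x∈L x∈L (antisym (x≤x∨y _ _) (∨-least refl (x∧y≤x _ _)))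

  -- Starting from the chain of the two bounds, the generators are adjoined one by one. The bounds
  -- make `z` itself available, as `m ∨ M ∧ z`.
  generate-between : ∀ {m M} → m ≤ M → ∀ l → All (Between m M) l →
    ∃[ L ] (Sublattice L × m ∈ₗ L × M ∈ₗ L × All (_∈ₗ L) l)
  generate-between {m} {M} m≤M [] [] =
    m ∷ M ∷ [] , chain , here Eq.refl , there (here Eq.refl) , []
    where
    comparable : ∀ {x y} → x ∈ₗ (m ∷ M ∷ []) → y ∈ₗ (m ∷ M ∷ []) → x ≤ y ⊎ y ≤ x
    comparable (here x≈m) (here y≈m) = inj₁ (reflexive (Eq.trans x≈m (Eq.sym y≈m)))
    comparable (here x≈m) (there (here y≈M)) =
      inj₁ (trans (reflexive x≈m) (trans m≤M (reflexive (Eq.sym y≈M))))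
    comparable (there (here x≈M)) (here y≈m) =
      inj₂ (trans (reflexive y≈m) (trans m≤M (reflexive (Eq.sym x≈M))))
    comparable (there (here x≈M)) (there (here y≈M)) = inj₁ (reflexive (Eq.trans x≈M (Eq.sym y≈M)))

    chain : Sublattice (m ∷ M ∷ [])
    chain x∈ y∈ with comparable x∈ y∈
    ... | inj₁ x≤y = ∈ₗ-resp (antisym (y≤x∨y _ _) (∨-least x≤y refl)) y∈
                   , ∈ₗ-resp (antisym (∧-greatest refl x≤y) (x∧y≤x _ _)) x∈
    ... | inj₂ y≤x = ∈ₗ-resp (antisym (x≤x∨y _ _) (∨-least refl y≤x)) x∈
                   , ∈ₗ-resp (antisym (∧-greatest y≤x refl) (x∧y≤y _ _)) y∈
  generate-between m≤M (z ∷ l) ((m≤z , z≤M) ∷ l∈)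
    with L , closed , m∈L , M∈L , l⊆L ← generate-between m≤M l l∈ =
    adjoin z L , adjoin-sublattice z closed , adjoin-⊇ z m∈L , adjoin-⊇ z M∈L ,
    adjoin-∈ m∈L M∈L (antisym (trans (∧-greatest z≤M refl) (y≤x∨y _ _)) (∨-least m≤z (x∧y≤y _ _)))
      ∷ All.map (adjoin-⊇ z) l⊆L

  generate : ∀ l → ∃[ L ] (Sublattice L × All (_∈ₗ L) l)
  generate [] = [] , (λ ()) , []
  generate (x ∷ l)
    with m , M , (m≤x , x≤M) ∷ l∈ ← bounds x l
    with L , closed , _ , _ , l⊆L ← generate-between (trans m≤x x≤M) (x ∷ l) ((m≤x , x≤M) ∷ l∈) =
    L , closed , l⊆L

  -- Reduction to finite systems.

  module Restriction {S : Subset} (isSystem : IsSystem S) (submodular : Submodular S) where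
    open IsSystem isSystem

    -- `L` is not known to be closed under the involution, so both orientations are required to lie
    -- in it.
    restrict : List Carrier → Subset
    restrict L x = x ∈ S × x ∈ₗ L × x * ∈ₗ L

    restrict-isSystem : ∀ {L} → IsSystem (restrict L)
    restrict-isSystem = record
      { respects = λ x≈y (x∈S , x∈L , x*∈L) →
          respects x≈y x∈S , ∈ₗ-resp x≈y x∈L , ∈ₗ-resp (*-cong x≈y) x*∈L
      ; *-closed = λ (x∈S , x∈L , x*∈L) →
          *-closed x∈S , x*∈L , ∈ₗ-resp (Eq.sym (*-involutive _)) x∈L
      }

    restrict-submodular : ∀ {L} → Sublattice L → Submodular (restrict L)
    restrict-submodular closed (x∈S , x∈L , x*∈L) (y∈S , y∈L , y*∈L) with submodular x∈S y∈S
    ... | inj₁ x∨y∈S = inj₁ ( x∨y∈S , proj₁ (closed x∈L y∈L)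
                            , ∈ₗ-resp (Eq.sym deMorgan-∨) (proj₂ (closed x*∈L y*∈L)))
    ... | inj₂ x∧y∈S = inj₂ ( x∧y∈S , proj₂ (closed x∈L y∈L)
                            , ∈ₗ-resp (Eq.sym deMorgan-∧) (proj₁ (closed x*∈L y*∈L)))

    -- The two trees use finitely many separations, which generate a finite
    -- sublattice, so that cut-wf applies to the part of S inside it.
    cut : ∀ {Q s} → DownClosed Q → Small ⊆ Q →
      Contradictory S (Q ⊕ s) → Contradictory S (Q ⊕ s *) → Contradictory S Q
    cut {Q} down small contr-s contr-s*
      with l , k , l⊆S , k⊆Q⊕s , contr₁ ← contradictory-support contr-s
         | l′ , k′ , l′⊆S , k′⊆Q⊕s* , contr₂ ← contradictory-support contr-s*
      with L , closed , ⊆L ← generate ((l ++ l′) ++ map _* (l ++ l′)) =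
      contradictory-mono proj₁ id (cut-wf (finite⇒wellFounded L (proj₁ ∘ proj₂)) Q down small
        (contr₁ _ _ (++⁻ˡ l ⊆S′) k⊆Q⊕s)
        (contr₂ _ _ (++⁻ʳ l ⊆S′) k′⊆Q⊕s*))
      where
      ⊆S′ : All (_∈ restrict L) (l ++ l′)
      ⊆S′ = All.zip (++⁺ l⊆S l′⊆S , All.zip (++⁻ˡ (l ++ l′) ⊆L , map⁻ (++⁻ʳ (l ++ l′) ⊆L)))

      open SubmodularSystem (restrict-isSystem {L}) (restrict-submodular closed)

  -- Maximal extension by transfinite recursion.

  module Maximal {S Q : Subset} (down : DownClosed Q) (¬contr : ¬ Contradictory S Q)
    (R : Rel Carrier ℓ) (isOrder : IsStrictTotalOrder _≡_ R) (wf : WellFounded R) where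
    open IsStrictTotalOrder isOrder using (compare) renaming (trans to R-trans)

    -- s is accepted if a contradiction does not arise from adding s to Q together
    -- with everything accepted earlier.
    Accepted-acc : ∀ s → Acc R s → Set ℓ
    Stage-acc : ∀ s → Acc R s → Subset

    Accepted-acc s (acc rs) = ¬ Contradictory S (λ x → Stage-acc s (acc rs) x ⊎ x ≤ s)
    Stage-acc s (acc rs) x = x ∈ Q ⊎ ∃[ t ] Σ[ t<s ∈ R t s ] (Accepted-acc t (rs t<s) × x ≤ t)

    -- The recursion runs over accessibility proofs; its outcome must not depend on them for
    -- `Accepted` to satisfy the intended recursion equation. Acceptance is a negation, so the
    -- stages are compared in the opposite direction.
    accepted-irrelevant : ∀ {s} (p q : Acc R s) → Accepted-acc s p → Accepted-acc s q
    stage-irrelevant : ∀ {s} (p q : Acc R s) → Stage-acc s p ⊆ Stage-acc s q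

    accepted-irrelevant {s} (acc rs) (acc rs′) accepted =
      accepted ∘ contradictory-mono id (⊎-map₁ (stage-irrelevant (acc rs′) (acc rs)))
    stage-irrelevant (acc rs) (acc rs′) (inj₁ x∈Q) = inj₁ x∈Q
    stage-irrelevant (acc rs) (acc rs′) (inj₂ (t , t<s , accepted , x≤t)) =
      inj₂ (t , t<s , accepted-irrelevant (rs t<s) (rs′ t<s) accepted , x≤t)

    Accepted : Subset
    Accepted s = Accepted-acc s (wf s)

    Stage : Carrier → Subset
    Stage s x = x ∈ Q ⊎ ∃[ t ] (R t s × t ∈ Accepted × x ≤ t)

    Q^ : Subset
    Q^ x = x ∈ Q ⊎ ∃[ t ] (t ∈ Accepted × x ≤ t)

    accepted⇒ : ∀ {s} → s ∈ Accepted → ¬ Contradictory S (Stage s ⊕ s)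
    accepted⇒ {s} with wf s
    ... | acc rs = λ accepted → accepted ∘ contradictory-mono id (⊎-map₁ λ
      { (inj₁ x∈Q) → inj₁ x∈Q
      ; (inj₂ (t , t<s , accepted , x≤t)) →
          inj₂ (t , t<s , accepted-irrelevant (wf t) (rs t<s) accepted , x≤t) })

    ⇒accepted : ∀ {s} → ¬ Contradictory S (Stage s ⊕ s) → s ∈ Accepted
    ⇒accepted {s} with wf s
    ... | acc rs = λ accepted → accepted ∘ contradictory-mono id (⊎-map₁ λ
      { (inj₁ x∈Q) → inj₁ x∈Q
      ; (inj₂ (t , t<s , accepted , x≤t)) →
          inj₂ (t , t<s , accepted-irrelevant (rs t<s) (wf t) accepted , x≤t) })

    Q^-down : DownClosed Q^
    Q^-down r≤s (inj₁ s∈Q) = inj₁ (down r≤s s∈Q)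
    Q^-down r≤s (inj₂ (t , t∈ , s≤t)) = inj₂ (t , t∈ , trans r≤s s≤t)

    -- Stages increase along the well-ordering, so finitely many elements outside or inside `Q` are
    -- all caught once the latest accepted bound `u` has been added.
    finite-stage : ∀ k → All (_∈ Q^) k →
      All (_∈ Q) k ⊎ ∃[ u ] (u ∈ Accepted × All (_∈ (Stage u ⊕ u)) k)
    finite-stage [] [] = inj₁ []
    finite-stage (x ∷ k) (x∈ ∷ k⊆) with x∈ | finite-stage k k⊆
    ... | inj₁ x∈Q | inj₁ k⊆Q = inj₁ (x∈Q ∷ k⊆Q)
    ... | inj₁ x∈Q | inj₂ (u , u∈ , k⊆u) = inj₂ (u , u∈ , inj₁ (inj₁ x∈Q) ∷ k⊆u)
    ... | inj₂ (t , t∈ , x≤t) | inj₁ k⊆Q = inj₂ (t , t∈ , inj₂ x≤t ∷ All.map (inj₁ ∘ inj₁) k⊆Q)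
    ... | inj₂ (t , t∈ , x≤t) | inj₂ (u , u∈ , k⊆u) with compare t u
    ...   | tri< t<u _ _ = inj₂ (u , u∈ , inj₁ (inj₂ (t , t<u , t∈ , x≤t)) ∷ k⊆u)
    ...   | tri≈ _ ≡.refl _ = inj₂ (u , u∈ , inj₂ x≤t ∷ k⊆u)
    ...   | tri> _ _ u<t = inj₂ (t , t∈ , inj₂ x≤t ∷ All.map (inj₁ ∘ raise) k⊆u)
      where
      raise : Stage u ⊕ u ⊆ Stage t
      raise (inj₁ (inj₁ y∈Q)) = inj₁ y∈Q
      raise (inj₁ (inj₂ (v , v<u , v∈ , y≤v))) = inj₂ (v , R-trans v<u u<t , v∈ , y≤v)
      raise (inj₂ y≤u) = inj₂ (u , u<t , u∈ , y≤u)

    ¬contr-Q^ : ¬ Contradictory S Q^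
    ¬contr-Q^ contr with l , k , l⊆S , k⊆ , contr′ ← contradictory-support contr
      with finite-stage k k⊆
    ... | inj₁ k⊆Q = ¬contr (contr′ S Q l⊆S k⊆Q)
    ... | inj₂ (u , u∈ , k⊆u) = accepted⇒ u∈ (contr′ S _ l⊆S k⊆u)

    -- A separation outside `Q^` was rejected, so it already gives a contradiction with its stage,
    -- which is part of `Q^`.
    maximal : ∀ {s} → s ∉ Q^ → Contradictory S (Q^ ⊕ s)
    maximal {s} s∉Q^ = contradictory-mono id (⊎-map₁ stage⊆) (decidable-stable em λ ¬c →
      s∉Q^ (inj₂ (s , ⇒accepted ¬c , refl)))
      where
      stage⊆ : Stage s ⊆ Q^
      stage⊆ (inj₁ x∈Q) = inj₁ x∈Q
      stage⊆ (inj₂ (t , _ , t∈ , x≤t)) = inj₂ (t , t∈ , x≤t)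

  extend-maximal : WellOrderingPrinciple ℓ → ∀ {S Q} → DownClosed Q → ¬ Contradictory S Q →
    ∃[ Q^ ] (DownClosed Q^ × Q ⊆ Q^ × ¬ Contradictory S Q^ ×
      (∀ {s} → s ∉ Q^ → Contradictory S (Q^ ⊕ s)))
  extend-maximal wo down ¬contr with R , isOrder , wf ← wo Carrier =
    Q^ , Q^-down , inj₁ , ¬contr-Q^ , maximal
    where open Maximal down ¬contr R isOrder wf

  -- The tangle of a maximal set.

  module Tangle {S Q : Subset} (isSystem : IsSystem S) (submodular : Submodular S)
    (down : DownClosed Q) (small : Small ⊆ Q) (¬contr : ¬ Contradictory S Q)
    (maximal : ∀ {s} → s ∉ Q → Contradictory S (Q ⊕ s)) where
    open IsSystem isSystem
    open SubmodularSystem isSystem submodular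
    open Restriction isSystem submodular

    not-both : ∀ {s} → s ∈ S → s ∈ Q → ¬ s * ∈ Q
    not-both s∈S s∈Q s*∈Q = ¬contr (_ , leaf s∈S s∈Q , leaf (*-closed s∈S) s*∈Q)

    tangle : IsAbstractTangle S (S ∩ Q)
    tangle = record
      { isOrientation = record
        { respects = λ x≈y (x∈S , x∈Q) → respects x≈y x∈S , down (reflexive (Eq.sym x≈y)) x∈Q
        ; subset   = proj₁
        ; atLeast  = atLeast
        ; atMost   = λ (s∈S , s∈Q) (_ , s*∈Q) → ⊥-elim (not-both s∈S s∈Q s*∈Q)
        }
      ; consistent = λ r∈S _ _ r≤s (_ , s∈Q) (_ , r*∈Q) → not-both r∈S (down r≤s s∈Q) r*∈Q
      ; avoids     = avoids
      }
      where
      atLeast : ∀ {s} → s ∈ S → s ∈ (S ∩ Q) ⊎ s * ∈ (S ∩ Q)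
      atLeast {s} s∈S with em {s ∈ Q} | em {s * ∈ Q}
      ... | yes s∈Q | _ = inj₁ (s∈S , s∈Q)
      ... | no _ | yes s*∈Q = inj₂ (*-closed s∈S , s*∈Q)
      ... | no s∉Q | no s*∉Q = ⊥-elim (¬contr (cut down small (maximal s∉Q) (maximal s*∉Q)))

      avoids : ∀ X → X ∈ 𝓣 → ¬ X ⊆ S ∩ Q
      avoids X (r , s , t , (_ , rst⊆X) , cs) X⊆ =
        let r∈S , r∈Q = X⊆ (rst⊆X {r} (inj₁ Eq.refl))
            s∈S , s∈Q = X⊆ (rst⊆X {s} (inj₂ (inj₁ Eq.refl)))
            t∈S , t∈Q = X⊆ (rst⊆X {t} (inj₂ (inj₂ Eq.refl)))
            r′ , s′ , t′ , r′∈S , s′∈S , t′∈S , r′≤r , s′≤s , t′≤t , star = uncross₃ r∈S s∈S t∈S cs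
        in ¬contr (t′ , leaf t′∈S (down t′≤t t∈Q)
                      , node star t′∈S
                          (leaf r′∈S (down r′≤r r∈Q)) (leaf s′∈S (down s′≤s s∈Q)) Eq.refl)

  -- Stars of the constructed trees, and the dichotomy.

  module _ {S : Subset} (isSystem : IsSystem S) (noDegenerate : NoDegenerate S) where
    open IsSystem isSystem

    𝓣*∪𝓕-resp : ∀ {Q X Y} → X ≐ Y → X ∈ (𝓣* ∪ 𝓕 Q) → Y ∈ (𝓣* ∪ 𝓕 Q)
    𝓣*∪𝓕-resp X≐Y (inj₁ ((r , s , t , X≐ , coSmall) , nondegenerate , nested)) =
      inj₁ ( (r , s , t , ≐-trans (≐-sym X≐Y) X≐ , coSmall)
           , nondegenerate ∘ proj₂ X≐Y
           , λ s∈Y t∈Y → nested (proj₂ X≐Y s∈Y) (proj₂ X≐Y t∈Y))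
    𝓣*∪𝓕-resp X≐Y (inj₂ (s , s∈Q , nondegenerate , X≐)) =
      inj₂ (s , s∈Q , nondegenerate , ≐-trans (≐-sym X≐Y) X≐)

    -- Small separations may be added to `Q` at no cost: if `t` is small, then `t *` is co-small, so
    -- its singleton is in `𝓣*` anyway.
    leaf∈𝓣*∪𝓕 : ∀ {Q t} → t ∈ S → t ∈ (Q ∪ Small) → ｛ t * ｝ ∈ (𝓣* ∪ 𝓕 Q)
    leaf∈𝓣*∪𝓕 t∈S (inj₁ t∈Q) = inj₂ (_ , t∈Q , noDegenerate t∈S , id , id)
    leaf∈𝓣*∪𝓕 t∈S (inj₂ t≤t*) = inj₁
      ( ( _ , _ , _ , (inj₁ , [ id , [ id , id ]′ ]′)
        , coSmall-upward (x≤x∨y _ _) (trans x**≤x t≤t*))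
      , (λ x≈t* → noDegenerate (respects (Eq.sym x≈t*) (*-closed t∈S)))
      , λ x≈t* y≈t* x≉y → ⊥-elim (x≉y (Eq.trans x≈t* (Eq.sym y≈t*))))

    starTriple∈𝓣*∪𝓕 : ∀ {Q r s t} → r ∈ S → s ∈ S → t ∈ S → StarTriple r s t →
      ｛_,_,_｝ r s t ∈ (𝓣* ∪ 𝓕 Q)
    starTriple∈𝓣*∪𝓕 {r = r} {s} {t} r∈S s∈S t∈S star = inj₁
      ((r , s , t , (id , id) , coSmall) , noDegenerate ∘ ∈S , nested)
      where
      open StarTriple star

      ∈S : ∀ {x} → x ∈ ｛_,_,_｝ r s t → x ∈ S
      ∈S (inj₁ x≈r)        = respects (Eq.sym x≈r) r∈S
      ∈S (inj₂ (inj₁ x≈s)) = respects (Eq.sym x≈s) s∈S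
      ∈S (inj₂ (inj₂ x≈t)) = respects (Eq.sym x≈t) t∈S

      transport : ∀ {x y x′ y′} → x ≈ x′ → y ≈ y′ → x′ ≤ y′ * → x ≤ y *
      transport x≈x′ y≈y′ x′≤y′* =
        trans (reflexive x≈x′) (trans x′≤y′* (*-antitone (reflexive y≈y′)))

      nested : ∀ {x y} → x ∈ ｛_,_,_｝ r s t → y ∈ ｛_,_,_｝ r s t → ¬ x ≈ y → x ≤ y *
      nested (inj₁ p)        (inj₁ q)        x≉y = ⊥-elim (x≉y (Eq.trans p (Eq.sym q)))
      nested (inj₁ p)        (inj₂ (inj₁ q)) _   = transport p q r≤s*
      nested (inj₁ p)        (inj₂ (inj₂ q)) _   = transport p q r≤t*
      nested (inj₂ (inj₁ p)) (inj₁ q)        _   = transport p q (≤*-swap r≤s*)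
      nested (inj₂ (inj₁ p)) (inj₂ (inj₁ q)) x≉y = ⊥-elim (x≉y (Eq.trans p (Eq.sym q)))
      nested (inj₂ (inj₁ p)) (inj₂ (inj₂ q)) _   = transport p q s≤t*
      nested (inj₂ (inj₂ p)) (inj₁ q)        _   = transport p q (≤*-swap r≤t*)
      nested (inj₂ (inj₂ p)) (inj₂ (inj₁ q)) _   = transport p q (≤*-swap s≤t*)
      nested (inj₂ (inj₂ p)) (inj₂ (inj₂ q)) x≉y = ⊥-elim (x≉y (Eq.trans p (Eq.sym q)))

  tangle⊎tree : WellOrderingPrinciple ℓ → ∀ {S Q} → IsSystem S → Submodular S →
    NoDegenerate S → DownClosed Q → HasTangleExtending S Q ⊎ HasSTreeOver S (𝓣* ∪ 𝓕 Q)
  tangle⊎tree wellOrder {S} {Q} isSystem submodular noDegenerate down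
    with em {Contradictory S (Q ∪ Small)}
  ... | yes contr = inj₂ (contradictory⇒tree contr)
    where
    open System isSystem
    open Trees (𝓣* ∪ 𝓕 Q) (𝓣*∪𝓕-resp isSystem noDegenerate)
      (leaf∈𝓣*∪𝓕 isSystem noDegenerate) (starTriple∈𝓣*∪𝓕 isSystem noDegenerate)
  ... | no ¬contr
    with Q^ , Q^-down , Q∪Small⊆Q^ , ¬contr^ , maximal ← extend-maximal wellOrder
      (λ { r≤s (inj₁ s∈Q)  → inj₁ (down r≤s s∈Q)
         ; r≤s (inj₂ s≤s*) → inj₂ (small-down r≤s s≤s*) }) ¬contr =
    inj₁ (S ∩ Q^ , tangle , λ (x∈Q , x∈S) → x∈S , Q∪Small⊆Q^ (inj₁ x∈Q))
    where open Tangle isSystem submodular Q^-down (Q∪Small⊆Q^ ∘ inj₂) ¬contr^ maximal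

theorem3 : ∀ {ℓ} → ExcludedMiddle ℓ → WellOrderingPrinciple ℓ →
    (U : Universe ℓ) → Universe.Distributive U →
    let open Separations U in
    (S Q : Subset) → IsSystem S → Submodular S → NoDegenerate S →
    DownClosed Q →
    ExactlyOne (HasTangleExtending S Q) (HasSTreeOver S (𝓣* ∪ 𝓕 Q))
theorem3 em wellOrder U distributive S Q isSystem submodular noDegenerate down =
    tangle⊎tree wellOrder isSystem submodular noDegenerate down
  , λ (tangle , tree) → tangle⇒¬tree em U isSystem tangle tree
  where open TangleTreeDuality em U distributive
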